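{- Let $x,y$ be integers with $1<x<y$, let $a,b,c\ge 0$ be integers, and let $L=\{1^a,x^b,y^c\}$ (a multiset of size $v-1$ where $v=a+b+c+1$). Then $L$ has a linear realization in each of the following cases: (1) $a\ge x+y-1$; (2) $a\ge x+y-2$, when $x=3$ or $x$ is even; (3) $a\ge 4x-3$, when $x$ is odd, $y>2x-2$, and $b\ge y-2x+2$; (4) $a\ge x$, when $y=tx$ with $x$ and $t$ odd, and $b\ge tx+2t-3$; (5) $a\ge 7$, when $x=3$ and $b\ge y-4$.
   Context: For a positive integer $v$, $K_v$ is the complete graph on vertex set $\{0,1,\dots,v-1\}$; the linear length of an edge $\{u,w\}$ is $|u-w|$. A multiset $L$ of positive integers of size $v-1$ has a linear realization if there is a Hamiltonian path in $K_v$ whose multiset of linear edge lengths equals $L$. The notation $\{x_1^{a_1},\dots,x_k^{a_k}\}$ denotes the multiset containing $x_i$ with multiplicity $a_i$. -}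

module Defs where

open import Data.Nat using (ℕ; suc; _+_; ∣_-_∣)
open import Data.List using (List; []; _∷_; upTo; replicate; _++_)
open import Data.List.Relation.Binary.Permutation.Propositional using (_↭_)
open import Data.Product using (Σ; _×_)

edgeLengths : List ℕ → List ℕ
edgeLengths [] = []
edgeLengths (u ∷ []) = []
edgeLengths (u ∷ w ∷ ws) = ∣ u - w ∣ ∷ edgeLengths (w ∷ ws)

-- A Hamiltonian path in K_v: a listing of the vertices 0..v-1, each exactly once
-- (i.e. a permutation of upTo v).
HamPath : ℕ → List ℕ → Set
HamPath v p = p ↭ upTo v

LinearRealization : ℕ → List ℕ → Set
LinearRealization v L = Σ (List ℕ) (λ p → HamPath v p × (edgeLengths p ↭ L))

mset : ℕ → ℕ → ℕ → ℕ → ℕ → List ℕ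
mset a x b y c = replicate a 1 ++ replicate b x ++ replicate c y

module Submission where

-- Arrange the vertices in y columns, the residue classes mod y.  The first R columns (the block P) have one vertex more than
-- the others (the block Q).  A path that runs through whole columns, alternately down and up, changes columns at the top or at
-- the bottom.  At the top, two columns are as far apart as their indices; so they are at the bottom within P and within Q,
-- where in addition column 0 is next to column y - 1 (the wrap).  Hence any walk over the column indices with steps 1 and x
-- inside each block, joined at the top or over the wrap, gives a realization of {1^a, x^b, y^c}, and only the parity of the number
-- of columns before a change of block matters.  It can be repaired by starting with a y-step, or by splitting one column.
-- The index walks are the same construction for x, with steps 1 only.
--
-- Realizations that start at 0 can be reflected and joined at 0.  Cases (1) and (2) join {1, x} to {1, y}, saving a 1 by an
-- x-step between columns or, for even x, by putting the {1, x}-walk above the columns as a bridge between two column walks.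
-- Cases (3) and (5) use index walks with mostly x-steps.  In case (4) the residue classes mod x carry walks with steps x and tx,
-- and consecutive classes are traversed by the same walk in opposite directions.

open import Defs
open import Data.Nat
open import Data.Nat.Properties
open import Data.Nat.Divisibility using (_∣_; divides)
open import Data.Nat.DivMod using (_/_; _%_; m≡m%n+[m/n]*n; m%n<n)
open import Data.Nat.Tactic.RingSolver using (solve-∀)
open import Data.Bool using (Bool; true; false; not)
open import Data.List using (List; []; _∷_; _++_; [_]; map; concatMap; length; upTo; applyUpTo; replicate)
open import Data.List.Properties using (++-identityʳ; ++-assoc; length-++; map-++; concatMap-++; concatMap-map)
open import Data.List.Relation.Unary.All using (All; []; _∷_)
open import Data.List.Relation.Unary.All.Properties using (++⁻ˡ; ++⁻ʳ)
import Data.List.Relation.Unary.All as All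
open import Data.List.Relation.Binary.Permutation.Propositional using (_↭_; ↭-refl; ↭-sym; ↭-trans; ↭-reflexive; prep; module PermutationReasoning)
open import Data.List.Relation.Binary.Permutation.Propositional.Properties using (++⁺; ++⁺ˡ; ++⁺ʳ; ++-comm; shift; shifts; drop-∷; ↭-length; map⁺; All-resp-↭)
open import Data.Product using (Σ; ∃₂; ∃-syntax; _×_; _,_; proj₂)
open import Data.Sum using (_⊎_; inj₁; inj₂)
open import Data.Unit using (⊤; tt)
open import Data.Empty using (⊥; ⊥-elim)
open import Relation.Nullary using (¬_)
open import Relation.Binary.PropositionalEquality using (_≡_; refl; sym; trans; cong; cong₂; subst; subst₂; module ≡-Reasoning)

-- A path from 0 that crosses the y columns with y - 1 horizontal steps has R equal to the residue
-- of c mod y. Starting with a y-step removes vertex 0 and lowers R by one; splitting a column costs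
-- one more horizontal step. So y - 1 ones suffice unless y and the residue are both odd and the
-- residue exceeds 1, and then y do; likewise for x. This gives x + y - 1 as soon as one of the two
-- joined parts is cheap. If both are expensive, handing one x-step to the y-part makes both cheap.
--
-- In (3) and (5) the passage between the blocks needs at most 2x - 3 ones. Another s ones go into
-- the second block and s into the separate {1, x}-part, where s = x in general and s = 2 for x = 3.
-- The sum 2s + 2x - 3 is 4x - 3 or 7.
--
-- In (4) the obstacle is that two classes traversed by the same walk carry equally many y-steps, so
-- only even amounts can be distributed in pairs. One class is left over to absorb the rest. If the
-- number of long classes is odd and above 1, three of them must be combined, and b ≥ tx + 2t - 3 is
-- what makes the remaining y-steps fit into the other classes.

-- Progressions

progression : ℕ → ℕ → ℕ → List ℕ
progression s d zero    = []
progression s d (suc n) = s ∷ progression (d + s) d n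

range : ℕ → ℕ → List ℕ
range s = progression s 1

length-progression : ∀ s d n → length (progression s d n) ≡ n
length-progression s d zero    = refl
length-progression s d (suc n) = cong suc (length-progression (d + s) d n)

range-++ : ∀ s m n → range s (m + n) ≡ range s m ++ range (s + m) n
range-++ s zero    n = cong (λ t → range t n) (sym (+-identityʳ s))
range-++ s (suc m) n = cong (s ∷_) (trans (range-++ (suc s) m n) (cong (λ t → range (suc s) m ++ range t n) (sym (+-suc s m))))

progression-last : ∀ s d n → progression s d (suc n) ↭ (n * d + s) ∷ progression s d n
progression-last s d zero    = ↭-refl
progression-last s d (suc n) = ↭-trans (prep s (progression-last (d + s) d n))
  (↭-trans (_↭_.swap s _ ↭-refl) (↭-reflexive (cong (_∷ s ∷ progression (d + s) d n) (eq n d s))))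
  where
  eq : ∀ n d s → n * d + (d + s) ≡ d + n * d + s
  eq = solve-∀

map-+-progression : ∀ k s d n → map (k +_) (progression s d n) ≡ progression (k + s) d n
map-+-progression k s d zero    = refl
map-+-progression k s d (suc n) = cong (k + s ∷_)
  (trans (map-+-progression k (d + s) d n) (cong (λ t → progression t d n) (eq k d s)))
  where
  eq : ∀ k d s → k + (d + s) ≡ d + (k + s)
  eq = solve-∀

map-*-range : ∀ β x s n → map (λ j → β + x * j) (range s n) ≡ progression (β + x * s) x n
map-*-range β x s zero    = refl
map-*-range β x s (suc n) = cong (β + x * s ∷_)
  (trans (map-*-range β x (suc s) n) (cong (λ t → progression t x n) (eq β x s)))
  where
  eq : ∀ β x s → β + x * suc s ≡ x + (β + x * s)
  eq = solve-∀

-- General in `f` because `upTo` unfolds to `applyUpTo` with ever more shifted functions.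
range≡applyUpTo : ∀ s n {f : ℕ → ℕ} → (∀ i → f i ≡ s + i) → range s n ≡ applyUpTo f n
range≡applyUpTo s zero    f≗ = refl
range≡applyUpTo s (suc n) f≗ = cong₂ _∷_ (sym (trans (f≗ 0) (+-identityʳ s)))
  (range≡applyUpTo (suc s) n (λ i → trans (f≗ (suc i)) (+-suc s i)))

range≡upTo : ∀ n → range 0 n ≡ upTo n
range≡upTo n = range≡applyUpTo 0 n (λ _ → refl)

-- The hypothesis puts the image of the last entry at `r`. In this additive form it survives the
-- induction without truncated subtraction.
range-reflect : ∀ r m s n → r + (s + n) ≡ suc m → map (m ∸_) (range s n) ↭ range r n
range-reflect r m s zero    eq = ↭-refl
range-reflect r m s (suc n) eq = ↭-trans (prep (m ∸ s) (range-reflect r m (suc s) n (trans (cong (r +_) (sym (+-suc s n))) eq)))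
  (↭-sym (↭-trans (progression-last r 1 n) (↭-reflexive (cong (_∷ range r n) n≡))))
  where
  eq′ : ∀ n r s → s + (n * 1 + r) + 1 ≡ r + (s + suc n)
  eq′ = solve-∀
  n≡ : n * 1 + r ≡ m ∸ s
  n≡ = trans (sym (m+n∸m≡n s (n * 1 + r))) (cong (_∸ s) (suc-injective (trans (+-comm 1 _) (trans (eq′ n r s) eq))))

range-< : ∀ s n → All (_< s + n) (range s n)
range-< s zero    = []
range-< s (suc n) = subst (s <_) (sym (+-suc s n)) (s≤s (m≤m+n s n)) ∷ subst (λ t → All (_< t) (range (suc s) n))
    (sym (+-suc s n)) (range-< (suc s) n)

-- Walks and tours

data Walk (x y : ℕ) : ℕ → ℕ → List ℕ → ℕ → ℕ → ℕ → Set where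
  stop  : ∀ {u} → Walk x y u u [ u ] 0 0 0
  step₁ : ∀ {u w e p a b c} → ∣ u - w ∣ ≡ 1 → Walk x y w e p a b c → Walk x y u e (u ∷ p) (suc a) b c
  stepˣ : ∀ {u w e p a b c} → ∣ u - w ∣ ≡ x → Walk x y w e p a b c → Walk x y u e (u ∷ p) a (suc b) c
  stepʸ : ∀ {u w e p a b c} → ∣ u - w ∣ ≡ y → Walk x y w e p a b c → Walk x y u e (u ∷ p) a b (suc c)

data Hop (x y u w : ℕ) : ℕ → ℕ → ℕ → Set where
  hop₁ : ∣ u - w ∣ ≡ 1 → Hop x y u w 1 0 0
  hopˣ : ∣ u - w ∣ ≡ x → Hop x y u w 0 1 0
  hopʸ : ∣ u - w ∣ ≡ y → Hop x y u w 0 0 1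

module _ {x y : ℕ} where

  move : ∀ {u w e p i j k a b c} → Hop x y u w i j k → Walk x y w e p a b c → Walk x y u e (u ∷ p) (i + a) (j + b) (k + c)
  move (hop₁ d) = step₁ d
  move (hopˣ d) = stepˣ d
  move (hopʸ d) = stepʸ d

  hop-isometry : ∀ {u w u′ w′ i j k} → ∣ u′ - w′ ∣ ≡ ∣ u - w ∣ → Hop x y u w i j k → Hop x y u′ w′ i j k
  hop-isometry eq (hop₁ d) = hop₁ (trans eq d)
  hop-isometry eq (hopˣ d) = hopˣ (trans eq d)
  hop-isometry eq (hopʸ d) = hopʸ (trans eq d)

  hop-sym : ∀ {u w i j k} → Hop x y u w i j k → Hop x y w u i j k
  hop-sym {u} {w} = hop-isometry (∣-∣-comm w u)

  glue : ∀ {s e s′ e′ p p′ a b c a′ b′ c′ i j k} → Walk x y s e p a b c → Hop x y e s′ i j k → Walk x y s′ e′ p′ a′ b′ c′ →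
         Walk x y s e′ (p ++ p′) (a + (i + a′)) (b + (j + b′)) (c + (k + c′))
  glue stop        h v = move h v
  glue (step₁ d w) h v = step₁ d (glue w h v)
  glue (stepˣ d w) h v = stepˣ d (glue w h v)
  glue (stepʸ d w) h v = stepʸ d (glue w h v)

  fuse : ∀ {s e e′ p p′ a b c a′ b′ c′} → Walk x y s e p a b c → Walk x y e e′ (e ∷ p′) a′ b′ c′ →
         Walk x y s e′ (p ++ p′) (a + a′) (b + b′) (c + c′)
  fuse stop        v = v
  fuse (step₁ d w) v = step₁ d (fuse w v)
  fuse (stepˣ d w) v = stepˣ d (fuse w v)
  fuse (stepʸ d w) v = stepʸ d (fuse w v)

  recount : ∀ {s e p a b c a′ b′ c′} → a ≡ a′ → b ≡ b′ → c ≡ c′ → Walk x y s e p a b c → Walk x y s e p a′ b′ c′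
  recount refl refl refl w = w

  snoc : ∀ {s e w p a b c i j k} → Walk x y s e p a b c → Hop x y e w i j k → Walk x y s w (p ++ [ w ]) (i + a) (j + b) (k + c)
  snoc stop h = move h stop
  snoc {i = i} (step₁ {a = a} d w) h = recount (sym (+-suc i a)) refl refl (step₁ d (snoc w h))
  snoc {j = j} (stepˣ {b = b} d w) h = recount refl (sym (+-suc j b)) refl (stepˣ d (snoc w h))
  snoc {k = k} (stepʸ {c = c} d w) h = recount refl refl (sym (+-suc k c)) (stepʸ d (snoc w h))

  backwards : ∀ {s e p a b c} → Walk x y s e p a b c → ∃[ q ] Walk x y e s q a b c × q ↭ p
  backwards stop = _ , stop , ↭-refl
  backwards (step₁ {u} d w) with backwards w
  ... | q , v , q↭ = _ , snoc v (hop-sym (hop₁ d)) , ↭-trans (++-comm q [ u ]) (prep u q↭)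
  backwards (stepˣ {u} d w) with backwards w
  ... | q , v , q↭ = _ , snoc v (hop-sym (hopˣ d)) , ↭-trans (++-comm q [ u ]) (prep u q↭)
  backwards (stepʸ {u} d w) with backwards w
  ... | q , v , q↭ = _ , snoc v (hop-sym (hopʸ d)) , ↭-trans (++-comm q [ u ]) (prep u q↭)

  walk-start : ∀ {s e p a b c} → Walk x y s e p a b c → ∃[ ps ] p ≡ s ∷ ps
  walk-start stop        = _ , refl
  walk-start (step₁ _ _) = _ , refl
  walk-start (stepˣ _ _) = _ , refl
  walk-start (stepʸ _ _) = _ , refl

  all-start : ∀ {Q : ℕ → Set} {s e p a b c} → Walk x y s e p a b c → All Q p → Q s
  all-start w qs with walk-start w
  all-start w (q ∷ _) | _ , refl = q

  walk-length : ∀ {s e p a b c} → Walk x y s e p a b c → length p ≡ suc (a + b + c)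
  walk-length stop = refl
  walk-length (step₁ _ w) = cong suc (walk-length w)
  walk-length (stepˣ {a = a} {b} {c} _ w) = cong suc (trans (walk-length w) (cong (_+ c) (sym (+-suc a b))))
  walk-length (stepʸ {a = a} {b} {c} _ w) = cong suc (trans (walk-length w) (sym (+-suc (a + b) c)))

  -- Distances need to be preserved only on `Q`, since `m ∸_` is an isometry only up to `m`.
  map-walk : ∀ {Q : ℕ → Set} {f : ℕ → ℕ} → (∀ {u w} → Q u → Q w → ∣ f u - f w ∣ ≡ ∣ u - w ∣) →
             ∀ {s e p a b c} → All Q p → Walk x y s e p a b c → Walk x y (f s) (f e) (map f p) a b c
  map-walk iso _        stop        = stop
  map-walk iso (q ∷ qs) (step₁ d w) = step₁ (trans (iso q (all-start w qs)) d) (map-walk iso qs w)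
  map-walk iso (q ∷ qs) (stepˣ d w) = stepˣ (trans (iso q (all-start w qs)) d) (map-walk iso qs w)
  map-walk iso (q ∷ qs) (stepʸ d w) = stepʸ (trans (iso q (all-start w qs)) d) (map-walk iso qs w)

-- A trip leaves the number of y-steps unspecified: it can be recovered from the length of V.
Tour : ℕ → ℕ → ℕ → ℕ → List ℕ → ℕ → ℕ → ℕ → Set
Tour x y s e V a b c = ∃[ p ] Walk x y s e p a b c × p ↭ V

Trip : ℕ → ℕ → ℕ → ℕ → List ℕ → ℕ → ℕ → Set
Trip x y s e V a b = ∃[ c ] Tour x y s e V a b c

∣m∸u-m∸w∣≡∣u-w∣ : ∀ {m u w} → u ≤ m → w ≤ m → ∣ m ∸ u - m ∸ w ∣ ≡ ∣ u - w ∣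
∣m∸u-m∸w∣≡∣u-w∣ {m} {u} {w} u≤m w≤m with m≤n⇒∃[o]m+o≡n u≤m | m≤n⇒∃[o]m+o≡n w≤m
... | i , refl | j , eq = begin
    ∣ u + i ∸ u - u + i ∸ w ∣   ≡⟨ cong₂ ∣_-_∣ (m+n∸m≡n u i) (trans (cong (_∸ w) (sym eq)) (m+n∸m≡n w j)) ⟩
    ∣ i - j ∣                   ≡⟨ ∣m+n-m+o∣≡∣n-o∣ w i j ⟨
    ∣ w + i - w + j ∣           ≡⟨ cong₂ ∣_-_∣ (+-comm w i) (trans eq (+-comm u i)) ⟩
    ∣ i + w - i + u ∣           ≡⟨ ∣m+n-m+o∣≡∣n-o∣ i w u ⟩
    ∣ w - u ∣                   ≡⟨ ∣-∣-comm w u ⟩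
    ∣ u - w ∣                   ∎
  where open ≡-Reasoning

module _ {x y : ℕ} where

  permute : ∀ {s e V V′ a b c} → V ↭ V′ → Tour x y s e V a b c → Tour x y s e V′ a b c
  permute V↭ (p , w , p↭) = p , w , ↭-trans p↭ V↭

  recountᵀ : ∀ {s e V a b c a′ b′ c′} → a ≡ a′ → b ≡ b′ → c ≡ c′ → Tour x y s e V a b c → Tour x y s e V a′ b′ c′
  recountᵀ refl refl refl t = t

  endsᵀ : ∀ {s e s′ e′ V a b c} → s ≡ s′ → e ≡ e′ → Tour x y s e V a b c → Tour x y s′ e′ V a b c
  endsᵀ refl refl t = t

  infixr 5 _◂_▸_
  _◂_▸_ : ∀ {s e s′ e′ V V′ a b c a′ b′ c′ i j k} → Tour x y s e V a b c → Hop x y e s′ i j k → Tour x y s′ e′ V′ a′ b′ c′ →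
          Tour x y s e′ (V ++ V′) (a + (i + a′)) (b + (j + b′)) (c + (k + c′))
  (_ , w , p↭) ◂ h ▸ (_ , w′ , p′↭) = _ , glue w h w′ , ++⁺ p↭ p′↭

  singleton : ∀ u → Tour x y u u [ u ] 0 0 0
  singleton u = _ , stop , ↭-refl

  reverseᵀ : ∀ {s e V a b c} → Tour x y s e V a b c → Tour x y e s V a b c
  reverseᵀ (_ , w , p↭) with backwards w
  ... | q , v , q↭ = q , v , ↭-trans q↭ p↭

  mapᵀ : ∀ (Q : ℕ → Set) (f : ℕ → ℕ) → (∀ {u w} → Q u → Q w → ∣ f u - f w ∣ ≡ ∣ u - w ∣) →
         ∀ {s e V a b c} → All Q V → Tour x y s e V a b c → Tour x y (f s) (f e) (map f V) a b c
  mapᵀ Q f iso qs (p , w , p↭) = map f p , map-walk iso (All-resp-↭ (↭-sym p↭) qs) w , map⁺ f p↭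

  translate : ∀ k {s e i n a b c} → Tour x y s e (range i n) a b c → Tour x y (k + s) (k + e) (range (k + i) n) a b c
  translate k {i = i} {n} t = permute (↭-reflexive (map-+-progression k i 1 n))
    (mapᵀ (λ _ → ⊤) (k +_) (λ {u} {w} _ _ → ∣m+n-m+o∣≡∣n-o∣ k u w) (All.universal (λ _ → tt) _) t)

  reflect : ∀ {s e m a b c} → Tour x y s e (range 0 (suc m)) a b c → Tour x y (m ∸ s) (m ∸ e) (range 0 (suc m)) a b c
  reflect {m = m} t = permute (range-reflect 0 m 0 (suc m) refl)
    (mapᵀ (_≤ m) (m ∸_) ∣m∸u-m∸w∣≡∣u-w∣ (All.map ≤-pred (range-< 0 (suc m))) t)

  tour-end : ∀ {Q : ℕ → Set} {s e V a b c} → Tour x y s e V a b c → All Q V → Q e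
  tour-end t qs with reverseᵀ t
  ... | _ , w , p↭ = all-start w (All-resp-↭ (↭-sym p↭) qs)

  tour-length : ∀ {s e V a b c} → Tour x y s e V a b c → length V ≡ suc (a + b + c)
  tour-length (_ , w , p↭) = trans (sym (↭-length p↭)) (walk-length w)

  pin : ∀ {s e n V a b c} → Trip x y s e V a b → length V ≡ n → n ≡ suc (a + b + c) → Tour x y s e V a b c
  pin {a = a} {b} (c′ , t) len eq = recountᵀ refl refl
    (+-cancelˡ-≡ (suc (a + b)) _ _ (trans (sym (tour-length t)) (trans len eq))) t

distance : ∀ {u w} d → u + d ≡ w → ∣ u - w ∣ ≡ d
distance {u} d refl = ∣m-m+n∣≡n u d

distance˘ : ∀ {u w} d → w + d ≡ u → ∣ u - w ∣ ≡ d
distance˘ {u} {w} d eq = trans (∣-∣-comm u w) (distance d eq)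

ascending : ∀ {x y} s n → Tour x y s (s + n) (range s (suc n)) n 0 0
ascending s zero    = endsᵀ refl (sym (+-identityʳ s)) (singleton s)
ascending s (suc n) = endsᵀ refl (sym (+-suc s n)) (singleton s ◂ hop₁ (distance 1 (+-comm s 1)) ▸ ascending (suc s) n)

descending : ∀ {x y} s n → Tour x y (s + n) s (range s (suc n)) n 0 0
descending s n = reverseᵀ (ascending s n)

infixr 5 _◃_▹_
_◃_▹_ : ∀ {x y s e s′ e′ V V′ a b a′ b′ i j k} → Trip x y s e V a b → Hop x y e s′ i j k → Trip x y s′ e′ V′ a′ b′ →
        Trip x y s e′ (V ++ V′) (a + (i + a′)) (b + (j + b′))
(_ , t) ◃ h ▹ (_ , t′) = _ , t ◂ h ▸ t′

permuteᵗ : ∀ {x y s e V V′ a b} → V ↭ V′ → Trip x y s e V a b → Trip x y s e V′ a b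
permuteᵗ V↭ (c , t) = c , permute V↭ t

reverseᵗ : ∀ {x y s e V a b} → Trip x y s e V a b → Trip x y e s V a b
reverseᵗ (c , t) = c , reverseᵀ t

recountᵗ : ∀ {x y s e V a b a′ b′} → a ≡ a′ → b ≡ b′ → Trip x y s e V a b → Trip x y s e V a′ b′
recountᵗ refl refl t = t

endsᵗ : ∀ {x y s e s′ e′ V a b} → s ≡ s′ → e ≡ e′ → Trip x y s e V a b → Trip x y s′ e′ V a b
endsᵗ refl refl t = t

-- Column walks

turn : ℕ → Bool → Bool
turn zero    d = d
turn (suc n) d = turn n (not d)

turn-even : ∀ k d → turn (k + k) d ≡ d
turn-even zero    d = refl
turn-even (suc k) d = trans (cong (λ n → turn n (not d)) (+-suc k k)) (trans (cong (turn (k + k)) (not-not d)) (turn-even k d))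
  where
  not-not : ∀ d → not (not d) ≡ d
  not-not true  = refl
  not-not false = refl

Even Odd : ℕ → Set
Even n = ∃[ k ] n ≡ k + k
Odd  n = ∃[ k ] n ≡ suc (k + k)

-- Direction true leads away from the base β, direction false towards it.
columns : ℕ → ℕ → ℕ → List ℕ → List ℕ
columns y β h = concatMap (λ j → progression (β + j) y (suc h))

level : ℕ → ℕ → ℕ → Bool → ℕ
level y β h true  = β
level y β h false = h * y + β

module _ {x y : ℕ} where

  column : ∀ s h → Tour x y s (h * y + s) (progression s y (suc h)) 0 0 h
  column s zero    = singleton s
  column s (suc h) = endsᵀ refl (eq h y s) (singleton s ◂ hopʸ (distance y (+-comm s y)) ▸ column (y + s) h)
    where
    eq : ∀ h y s → h * y + (y + s) ≡ suc h * y + s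
    eq = solve-∀

  directed : ∀ β h d j → Trip x y (level y β h d + j) (level y β h (not d) + j) (progression (β + j) y (suc h)) 0 0
  directed β h true  j = _ , endsᵀ refl (sym (+-assoc (h * y) β j)) (column (β + j) h)
  directed β h false j = _ , reverseᵀ (endsᵀ refl (sym (+-assoc (h * y) β j)) (column (β + j) h))

  hop-level : ∀ {u w i j k} L → Hop x y u w i j k → Hop x y (L + u) (L + w) i j k
  hop-level {u} {w} L = hop-isometry (∣m+n-m+o∣≡∣n-o∣ L u w)

  -- Consecutive columns are traversed in opposite directions, so each hop joins two vertices on the
  -- same level and has the length of the index step.
  expand-walk : ∀ {s e p a b} → Walk x y s e p a b 0 → ∀ β h d →
                Trip x y (level y β h d + s) (level y β h (turn (length p) d) + e) (columns y β h p) a b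
  expand-walk stop β h d = permuteᵗ (↭-reflexive (sym (++-identityʳ _))) (directed β h d _)
  expand-walk (step₁ δ w) β h d = directed β h d _ ◃ hop-level (level y β h (not d)) (hop₁ δ) ▹ expand-walk w β h (not d)
  expand-walk (stepˣ δ w) β h d = directed β h d _ ◃ hop-level (level y β h (not d)) (hopˣ δ) ▹ expand-walk w β h (not d)

  columns-↭ : ∀ {β h p q} → p ↭ q → columns y β h p ↭ columns y β h q
  columns-↭ _↭_.refl = ↭-refl
  columns-↭ {β} {h} (_↭_.prep j p↭q) = ++⁺ˡ (progression (β + j) y (suc h)) (columns-↭ p↭q)
  columns-↭ {β} {h} (_↭_.swap i j p↭q) = ↭-trans (shifts (progression (β + i) y (suc h)) (progression (β + j) y (suc h)))
    (++⁺ˡ (progression (β + j) y (suc h)) (++⁺ˡ (progression (β + i) y (suc h)) (columns-↭ p↭q)))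
  columns-↭ (_↭_.trans p↭q q↭r) = ↭-trans (columns-↭ p↭q) (columns-↭ q↭r)

  expand : ∀ {s e V a b n} → Tour x y s e V a b 0 → ∀ β h d → length V ≡ n →
           Trip x y (level y β h d + s) (level y β h (turn n d) + e) (columns y β h V) a b
  expand (p , w , p↭) β h d len = endsᵗ refl (cong (λ n → level y β h (turn n d) + _) (trans (↭-length p↭) len))
    (permuteᵗ (columns-↭ p↭) (expand-walk w β h d))

  -- All of a column of height at least two except the vertex at which direction d enters it.
  remainder : ∀ β h d j → ∃₂ λ e V → Trip x y (level y β (suc h) (not d) + j) e V 0 0 ×
              (level y β (suc h) d + j) ∷ V ↭ progression (β + j) y (2 + h)
  remainder β h true j = _ , _ ,
    (_ , reverseᵀ (endsᵀ refl (eq h y β j) (column (y + (β + j)) h))) , ↭-refl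
    where
    eq : ∀ h y β j → h * y + (y + (β + j)) ≡ suc h * y + β + j
    eq = solve-∀
  remainder β h false j = _ , _ , (_ , column (β + j) h) ,
    ↭-trans (↭-reflexive (cong (_∷ progression (β + j) y (suc h)) (+-assoc (suc h * y) β j)))
        (↭-sym (progression-last (β + j) y (suc h)))

  -- The last two columns w, w′ are visited in the order: one vertex of w, all of w′, the rest of w.
  -- This takes one step more than visiting w and then w′ and so changes the parity.
  expand-split : ∀ {s w w′ p a b i j} → Walk x y s w p a b 0 → Hop x y w w′ i j 0 → ∀ β h d →
                 ∃[ e ] Trip x y (level y β (suc h) d + s) e (columns y β (suc h) (p ++ [ w′ ])) (a + (i + i)) (b + (j + j))
  expand-split {s} {w′ = w′} {i = i} {j} stop hop β h d with remainder β h d s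
  ... | e , V , t , V↭ = e , recountᵗ (cong (i +_) (+-identityʳ i)) (cong (j +_) (+-identityʳ j)) (permuteᵗ perm
      ((_ , singleton (level y β (suc h) d + s)) ◃ hop-level (level y β (suc h) d) hop ▹ directed β (suc h) d w′
        ◃ hop-level (level y β (suc h) (not d)) (hop-sym hop) ▹ t))
    where
    C = progression (β + w′) y (2 + h)
    perm : (level y β (suc h) d + s) ∷ (C ++ V) ↭ columns y β (suc h) (s ∷ w′ ∷ [])
    perm = ↭-trans (prep _ (++-comm C V)) (↭-trans (++⁺ʳ C V↭)
        (↭-reflexive (cong (progression (β + s) y (2 + h) ++_) (sym (++-identityʳ C)))))
  expand-split (step₁ δ v) hop β h d with expand-split v hop β h (not d)
  ... | e , t = e , (directed β (suc h) d _ ◃ hop-level (level y β (suc h) (not d)) (hop₁ δ) ▹ t)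
  expand-split (stepˣ δ v) hop β h d with expand-split v hop β h (not d)
  ... | e , t = e , (directed β (suc h) d _ ◃ hop-level (level y β (suc h) (not d)) (hopˣ δ) ▹ t)

exit-even : ∀ {y β h e n d} → Even n → level y β h (turn n d) + e ≡ level y β h d + e
exit-even {y} {β} {h} {e} {d = d} (k , refl) = cong (λ δ → level y β h δ + e) (turn-even k d)

exit-odd : ∀ {y β h e n d} → Odd n → level y β h (turn n d) + e ≡ level y β h (not d) + e
exit-odd {y} {β} {h} {e} {d = d} (k , refl) = cong (λ δ → level y β h δ + e) (turn-even k (not d))

length-range : ∀ s n → length (range s n) ≡ n
length-range s n = length-progression s 1 n

columns-++ : ∀ y β h p q → columns y β h p ++ columns y β h q ≡ columns y β h (p ++ q)
columns-++ y β h p q = sym (concatMap-++ (λ j → progression (β + j) y (suc h)) p q)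

columns-rows : ∀ y β h s n → columns y β (suc h) (range s n) ↭ range (β + s) n ++ columns y (y + β) h (range s n)
columns-rows y β h s zero    = ↭-refl
columns-rows y β h s (suc n) = prep (β + s) (begin
    progression (y + (β + s)) y (suc h) ++ columns y β (suc h) (range (suc s) n)
      ↭⟨ ++⁺ (↭-reflexive (cong (λ t → progression t y (suc h)) (sym (+-assoc y β s)))) (columns-rows y β h (suc s) n) ⟩
    progression (y + β + s) y (suc h) ++ range (β + suc s) n ++ columns y (y + β) h (range (suc s) n)
      ↭⟨ shifts (progression (y + β + s) y (suc h)) (range (β + suc s) n) ⟩
    range (β + suc s) n ++ progression (y + β + s) y (suc h) ++ columns y (y + β) h (range (suc s) n)
      ≡⟨ cong (λ t → range t n ++ progression (y + β + s) y (suc h) ++ columns y (y + β) h (range (suc s) n)) (+-suc β s) ⟩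
    range (suc (β + s)) n ++ progression (y + β + s) y (suc h) ++ columns y (y + β) h (range (suc s) n) ∎)
  where open PermutationReasoning

columns-row : ∀ y β s n → columns y β 0 (range s n) ≡ range (β + s) n
columns-row y β s zero    = refl
columns-row y β s (suc n) = cong (β + s ∷_) (trans (columns-row y β (suc s) n) (cong (λ t → range t n) (+-suc β s)))

-- Induction on the rows: the first row is N, ..., N + y - 1, and what follows is the same picture
-- over base y + N with all columns one shorter.
cover : ∀ R S N h → columns (R + S) N (suc h) (range 0 R) ++ columns (R + S) (N + R) h (range 0 S) ↭ range N (suc h * (R + S) + R)
cover R S N zero = begin
    columns y N 1 (range 0 R) ++ columns y (N + R) 0 (range 0 S)
      ↭⟨ ++⁺ (columns-rows y N 0 0 R) (↭-reflexive (columns-row y (N + R) 0 S)) ⟩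
    (range (N + 0) R ++ columns y (y + N) 0 (range 0 R)) ++ range (N + R + 0) S
      ≡⟨ cong₂ _++_ (cong₂ (λ s t → range s R ++ t) (+-identityʳ N) (columns-row y (y + N) 0 R))
          (cong (λ s → range s S) (+-identityʳ (N + R))) ⟩
    (range N R ++ range (y + N + 0) R) ++ range (N + R) S
      ↭⟨ ++-comm (range N R ++ range (y + N + 0) R) (range (N + R) S) ⟩
    range (N + R) S ++ range N R ++ range (y + N + 0) R
      ↭⟨ shifts (range (N + R) S) (range N R) ⟩
    range N R ++ range (N + R) S ++ range (y + N + 0) R
      ≡⟨ ++-assoc (range N R) (range (N + R) S) _ ⟨
    (range N R ++ range (N + R) S) ++ range (y + N + 0) R
      ≡⟨ cong₂ _++_ (sym (range-++ N R S)) (cong (λ s → range s R) (eq y N)) ⟩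
    range N y ++ range (N + y) R
      ≡⟨ range-++ N y R ⟨
    range N (y + R)
      ≡⟨ cong (λ n → range N (n + R)) (sym (+-identityʳ y)) ⟩
    range N (1 * y + R) ∎
  where
  open PermutationReasoning
  y = R + S
  eq : ∀ y N → y + N + 0 ≡ N + y
  eq = solve-∀
cover R S N (suc h) = begin
    columns y N (2 + h) (range 0 R) ++ columns y (N + R) (suc h) (range 0 S)
      ↭⟨ ++⁺ (columns-rows y N (suc h) 0 R) (columns-rows y (N + R) h 0 S) ⟩
    (range (N + 0) R ++ P) ++ (range (N + R + 0) S ++ columns y (y + (N + R)) h (range 0 S))
      ≡⟨ cong₂ (λ s t → (s ++ P) ++ t) (cong (λ s → range s R) (+-identityʳ N))
          (cong₂ _++_ (cong (λ s → range s S) (+-identityʳ (N + R)))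
          (cong (λ β → columns y β h (range 0 S)) (sym (+-assoc y N R)))) ⟩
    (range N R ++ P) ++ (range (N + R) S ++ Q)
      ≡⟨ ++-assoc (range N R) P _ ⟩
    range N R ++ P ++ range (N + R) S ++ Q
      ↭⟨ ++⁺ˡ (range N R) (shifts P (range (N + R) S)) ⟩
    range N R ++ range (N + R) S ++ P ++ Q
      ≡⟨ ++-assoc (range N R) (range (N + R) S) _ ⟨
    (range N R ++ range (N + R) S) ++ P ++ Q
      ↭⟨ ++⁺ (↭-reflexive (sym (range-++ N R S))) (cover R S (y + N) h) ⟩
    range N y ++ range (y + N) (suc h * y + R)
      ≡⟨ cong (λ s → range N y ++ range s (suc h * y + R)) (+-comm y N) ⟩
    range N y ++ range (N + y) (suc h * y + R)
      ≡⟨ range-++ N y (suc h * y + R) ⟨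
    range N (y + (suc h * y + R))
      ≡⟨ cong (range N) (sym (+-assoc y (suc h * y) R)) ⟩
    range N (suc (suc h) * y + R) ∎
  where
  open PermutationReasoning
  y = R + S
  P = columns y (y + N) (suc h) (range 0 R)
  Q = columns y (y + N + R) h (range 0 S)

-- Passing from one block of columns to the other

-- A walk over all of 0, …, K - 1 from 0, together with a hop from its end to K; the indices count the hops.
data Link (x y K : ℕ) : ℕ → ℕ → Set where
  link : ∀ {e a b i j} → Tour x y 0 e (range 0 K) a b 0 → Hop x y e K i j 0 → Link x y K (a + i) (b + j)

-- A walk over all of 0, …, n - 1 from 0 with its last hop counted twice.
data Split (x y n : ℕ) : ℕ → ℕ → Set where
  split : ∀ {w w′ p a b i j} → Walk x y 0 w p a b 0 → Hop x y w w′ i j 0 → p ++ [ w′ ] ↭ range 0 n → Split x y n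
      (a + (i + i)) (b + (j + j))

record Reflected (x y R s : ℕ) (a b i j : ℕ) : Set where
  constructor reflected
  field
    {w w′} : ℕ
    {p}    : List ℕ
    walk   : Walk x y s w p a b 0
    hop    : Hop x y w w′ i j 0
    perm   : p ++ [ w′ ] ↭ range 0 R

module _ {x y : ℕ} where

  reflect-split : ∀ {m w w′ p a b i j} → Walk x y 0 w p a b 0 → Hop x y w w′ i j 0 → p ++ [ w′ ] ↭ range 0 (suc m) →
      Reflected x y (suc m) m a b i j
  reflect-split {m} {w} {w′} {p} v hop perm = reflected
      (map-walk ∣m∸u-m∸w∣≡∣u-w∣ (++⁻ˡ p bound) v)
      (hop-isometry (∣m∸u-m∸w∣≡∣u-w∣ (all-end v (++⁻ˡ p bound)) (All.head (++⁻ʳ p bound))) hop)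
      (↭-trans (↭-reflexive (sym (map-++ (m ∸_) p [ w′ ]))) (↭-trans (map⁺ (m ∸_) perm) (range-reflect 0 m 0 (suc m) refl)))
    where
    bound : All (_≤ m) (p ++ [ w′ ])
    bound = All-resp-↭ (↭-sym perm) (All.map ≤-pred (range-< 0 (suc m)))
    all-end : ∀ {Q : ℕ → Set} {s e p a b c} → Walk x y s e p a b c → All Q p → Q e
    all-end v qs = tour-end (_ , v , ↭-refl) qs

  -- The target S of a link is mirrored to the position just before column 0 of Q, which is the last
  -- column of P.
  reflect-hop : ∀ {e i j} R′ S′ → e ≤ S′ → Hop x y e (suc S′) i j 0 → Hop x y (suc (suc R′) + (S′ ∸ e)) (suc R′) i j 0
  reflect-hop {e} R′ S′ e≤ = hop-isometry (begin
      ∣ suc (suc R′) + (S′ ∸ e) - suc R′ ∣   ≡⟨ ∣-∣-comm (suc (suc R′) + (S′ ∸ e)) (suc R′) ⟩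
      ∣ suc R′ - suc (suc R′) + (S′ ∸ e) ∣   ≡⟨ distance {suc R′} (suc (S′ ∸ e)) (+-suc (suc R′) (S′ ∸ e)) ⟩
      suc (S′ ∸ e)                           ≡⟨ +-∸-assoc 1 e≤ ⟨
      suc S′ ∸ e                             ≡⟨ m≤n⇒∣m-n∣≡n∸m (≤-trans e≤ (n≤1+n S′)) ⟨
      ∣ e - suc S′ ∣                         ∎)
    where open ≡-Reasoning

  end≤ : ∀ {s e m a b c} → Tour x y s e (range 0 (suc m)) a b c → e ≤ m
  end≤ {m = m} t = ≤-pred (tour-end t (range-< 0 (suc m)))

  only-Q : ∀ {e a b} → Tour x y 0 e (range 0 y) a b 0 → ∀ h → Trip x y 0 (level y 0 h (turn y true) + e) (range 0 (suc h * y)) a b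
  only-Q t h = permuteᵗ (↭-trans (cover 0 y 0 h) (↭-reflexive (cong (range 0) (+-identityʳ (suc h * y)))))
    (expand t 0 h true (length-range 0 y))

  -- After an even number of columns the path is at the top again, where column R is the first
  -- column of Q and the hop of the link applies.
  P-then-Q : ∀ {R S l m e a b} → R + S ≡ y → Even R → Link x y R l m → Tour x y 0 e (range 0 S) a b 0 → ∀ h →
             Trip x y 0 (level y R h (turn S true) + e) (range 0 (suc h * y + R)) (l + a) (m + b)
  P-then-Q {R} {S} {a = a} {b} refl even (link {a = a′} {b′} {i} {j} tᴾ hop) tᴽ h =
    recountᵗ (sym (+-assoc a′ i a)) (sym (+-assoc b′ j b)) (permuteᵗ (cover R S 0 h)
      (endsᵗ refl (exit-even even) (expand tᴾ 0 (suc h) true (length-range 0 R))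
        ◃ hop ▹ endsᵗ (+-identityʳ R) refl (expand tᴽ R h true (length-range 0 S))))

  -- The initial y-step leads from 0 to the top of the last column over base 1, hence the reflected
  -- order of the columns.
  only-Q˘ : ∀ {y′ e a b} → y ≡ suc y′ → Tour x y 0 e (range 0 y) a b 0 → ∀ h →
            Trip x y 0 (level y 1 h (turn y true) + (y′ ∸ e)) (range 0 (suc (suc h * y))) a b
  only-Q˘ {y′} refl t h = permuteᵗ (prep 0 (↭-trans (cover 0 y 1 h) (↭-reflexive (cong (range 1) (+-identityʳ (suc h * y))))))
    ((_ , singleton 0) ◃ hopʸ refl ▹ expand (reflect t) 1 h true (length-range 0 y))

  -- After the initial y-step Q comes first, so now the number of its columns has to be even.
  Q-then-P : ∀ {R′ S′ l m e a b} → suc R′ + suc S′ ≡ y → Even (suc S′) → Link x y (suc S′) l m → Tour x y 0 e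
      (range 0 (suc R′)) a b 0 → ∀ h →
             Trip x y 0 (level y 1 (suc h) (turn (suc R′) true) + (R′ ∸ e)) (range 0 (suc (suc h * y + suc R′))) (l + a) (m + b)
  Q-then-P {R′} {S′} {a = a} {b} refl even (link {e} {a′} {b′} {i} {j} tᴽ hop) tᴾ h =
    recountᵗ (sym (+-assoc a′ i a)) (sym (+-assoc b′ j b))
      (permuteᵗ (prep 0 (↭-trans (++-comm (columns y (suc R) h (range 0 S)) _) (cover R S 1 h)))
        ((_ , singleton 0) ◃ hopʸ (cong suc (sym (+-suc R′ S′))) ▹
         endsᵗ refl (exit-even even) (expand (reflect tᴽ) (suc R) h true (length-range 0 S))
           ◃ reflect-hop R′ S′ (end≤ tᴽ) hop ▹ expand (reflect tᴾ) 1 (suc h) true (length-range 0 R)))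
    where
    R = suc R′
    S = suc S′

  -- On the same vertices as in `Q-then-P` the split takes one horizontal step more and hence one
  -- y-step less. This reaches the neighbouring residue of c.
  Q-then-split-P : ∀ {R′ S′ l m a b} → suc R′ + suc S′ ≡ y → Even (suc S′) → Link x y (suc S′) l m → Split x y (suc R′) a b → ∀ h →
                   ∃[ e ] Trip x y 0 e (range 0 (suc (suc h * y + suc R′))) (l + a) (m + b)
  Q-then-split-P {R′} {S′} refl even (link {e} {a′} {b′} {i} {j} tᴽ hop) (split {a = a} {b} {i′} {j′} v hop′ perm) h
    with reflect-split v hop′ perm
  ... | reflected v′ hop″ perm′ with expand-split v′ hop″ 1 h true
  ... | e″ , t = e″ , recountᵗ (sym (+-assoc a′ i (a + (i′ + i′)))) (sym (+-assoc b′ j (b + (j′ + j′))))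
      (permuteᵗ (prep 0 (↭-trans (++-comm (columns y (suc R) h (range 0 S)) _)
          (↭-trans (++⁺ʳ _ (columns-↭ {x} perm′)) (cover R S 1 h))))
        ((_ , singleton 0) ◃ hopʸ (cong suc (sym (+-suc R′ S′))) ▹
         endsᵗ refl (exit-even even) (expand (reflect tᴽ) (suc R) h true (length-range 0 S))
           ◃ reflect-hop R′ S′ (end≤ tᴽ) hop ▹ t))
    where
    R = suc R′
    S = suc S′

  -- Used when R is odd and R ≤ x: an x-step from 0 leads to column x - 1, the columns x - 1, …, 0 are visited
  -- in descending order and the far end of column 0 is adjacent to that of column y - 1.
  wrap-around : ∀ {R′ g M′ e a b} → Odd (suc R′) → Even g → suc R′ + g ≡ x → x + suc M′ ≡ y →
                Tour x y 0 e (range 0 (suc M′)) a b 0 → ∀ h → ∃[ e′ ] Trip x y 0 e′ (range 0 (suc (suc h * y + suc R′)))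
                    (x + a) (suc b)
  wrap-around {R′} {g} {M′} {e} {a} {b} odd even refl refl t h = _ , proj₂ (whole g even refl)
    where
    R = suc R′
    S = g + suc M′

    R+S : R + S ≡ y
    R+S = sym (+-assoc R g (suc M′))

    cover′ : columns y 1 (suc h) (range 0 R) ++ columns y (suc R) h (range 0 S) ↭ range 1 (suc h * y + R)
    cover′ = subst (λ z → columns z 1 (suc h) (range 0 R) ++ columns z (suc R) h (range 0 S) ↭ range 1 (suc h * z + R))
        R+S (cover R S 1 h)

    -- The columns of P reach one row further, so the far end of column 0 comes directly after that
    -- of column y - 1.
    wrap : h * y + suc R + (g + M′) + 1 ≡ suc h * y + 1 + 0
    wrap = eq h y R g M′
      where
      eq : ∀ h y R g M′ → h * (R + g + suc M′) + suc R + (g + M′) + 1 ≡ suc h * (R + g + suc M′) + 1 + 0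
      eq = solve-∀

    tail : Trip x y R _ (columns y 1 (suc h) (range 0 R) ++ columns y (suc R) h (range g (suc M′))) (R′ + suc a) b
    tail = endsᵗ refl (exit-odd odd) (expand (descending 0 R′) 1 (suc h) true (length-range 0 R))
      ◃ hop₁ (distance˘ 1 wrap) ▹ expand (subst (λ s → Tour x y (g + M′) (g + (M′ ∸ e)) (range s (suc M′)) a b 0)
          (+-identityʳ g) (translate g (reflect t))) (suc R) h false (length-range g (suc M′))

    whole : ∀ g₀ → Even g₀ → g₀ ≡ g → ∃[ e′ ] Trip x y 0 e′ (range 0 (suc (suc h * y + R))) (x + a) (suc b)
    -- For g = 0 the x-step lands in the last column of P itself. Otherwise it lands in Q, and the
    -- even number g of columns leads to the top of P.
    whole zero _ refl = _ , recountᵗ (trans (+-suc R′ a) (cong (_+ a) (sym (+-identityʳ R)))) refl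
      (permuteᵗ (prep 0 cover′) ((_ , singleton 0) ◃ hopˣ (sym (+-identityʳ R)) ▹ tail))
    whole (suc g′) even refl = _ , recountᵗ (eq g′ R′ a) refl
      (permuteᵗ (prep 0 (↭-trans (shifts (columns y (suc R) h (range 0 g)) (columns y 1 (suc h) (range 0 R)))
        (↭-trans (++⁺ˡ (columns y 1 (suc h) (range 0 R)) (↭-reflexive (trans (columns-++ y (suc R) h (range 0 g) (range g (suc M′)))
          (cong (columns y (suc R) h) (sym (range-++ 0 g (suc M′))))))) cover′)))
        ((_ , singleton 0) ◃ hopˣ (cong suc (sym (+-suc R′ g′))) ▹
         endsᵗ refl (exit-even even) (expand (descending 0 g′) (suc R) h true (length-range 0 g))
           ◃ hop₁ (distance˘ {suc R + 0} {R} 1 (trans (+-comm R 1) (sym (+-identityʳ (suc R))))) ▹ tail))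
      where
      eq : ∀ g′ R′ a → g′ + suc (R′ + suc a) ≡ suc R′ + suc g′ + a
      eq = solve-∀

-- Bridges between two column walks

-- Two tours that start at the tops of columns 0 and f and together visit the columns over base N.
record Arms (x y N f n : ℕ) : Set where
  constructor arms
  field
    {e₁ e₂ a₁ a₂} : ℕ
    {V₁ V₂}       : List ℕ
    arm₁          : Trip x y N e₁ V₁ a₁ 0
    arm₂          : Trip x y (N + f) e₂ V₂ a₂ 0
    disjoint      : V₂ ++ V₁ ↭ range N n
    size          : 2+ (a₁ + a₂) ≡ y

module _ {x y : ℕ} where

  -- Column f lies in Q. The first arm goes down column 0, wraps to column y - 1 and runs back to
  -- column f + 1. The second runs from f through the beginning of Q, an even number of columns, and
  -- so enters P at the top.
  arms-low : ∀ {R q r} N → 2+ R + (suc q + suc r) ≡ y → Even (suc q) → ∀ h → Arms x y N (2+ R + q) (suc h * y + 2+ R)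
  arms-low {R} {q} {r} N refl even h = arms
      ((endsᵗ (+-identityʳ N) refl (expand (singleton 0) N (suc h) true refl))
        ◃ hop₁ (distance˘ 1 (wrap h R q r N)) ▹ expand (descending (suc q) r) (N + R₂) h false (length-range (suc q) (suc r)))
      (endsᵗ (+-assoc N R₂ q) (exit-even even) (expand (descending 0 q) (N + R₂) h true (length-range 0 (suc q)))
        ◃ hop₁ (distance˘ {N + R₂ + 0} 1 (last N R)) ▹ expand (descending 1 R) N (suc h) true (length-range 1 (suc R)))
      (begin
        (Q₁ ++ P₁) ++ P₀ ++ Q₀   ≡⟨ ++-assoc Q₁ P₁ _ ⟩
        Q₁ ++ P₁ ++ P₀ ++ Q₀     ↭⟨ ++⁺ˡ Q₁ (shifts P₁ P₀) ⟩
        Q₁ ++ P₀ ++ P₁ ++ Q₀     ≡⟨ cong (Q₁ ++_) (trans (sym (++-assoc P₀ P₁ Q₀))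
            (cong (_++ Q₀) (columns-++ y N (suc h) [ 0 ] (range 1 (suc R))))) ⟩
        Q₁ ++ P ++ Q₀            ↭⟨ shifts Q₁ P ⟩
        P ++ Q₁ ++ Q₀            ≡⟨ cong (P ++_) (trans (columns-++ y (N + R₂) h (range 0 (suc q))
            (range (suc q) (suc r))) (cong (columns y (N + R₂) h) (sym (range-++ 0 (suc q) (suc r))))) ⟩
        P ++ columns y (N + R₂) h (range 0 (suc q + suc r))   ↭⟨ cover R₂ (suc q + suc r) N h ⟩
        range N (suc h * y + R₂) ∎)
      (size R q r)
    where
    open PermutationReasoning
    R₂ = 2+ R
    P₀ = columns y N (suc h) [ 0 ]
    P₁ = columns y N (suc h) (range 1 (suc R))
    P  = columns y N (suc h) (range 0 R₂)
    Q₁ = columns y (N + R₂) h (range 0 (suc q))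
    Q₀ = columns y (N + R₂) h (range (suc q) (suc r))
    wrap : ∀ h R q r N → h * (2+ R + (suc q + suc r)) + (N + 2+ R) + (suc q + r) + 1 ≡ suc h * (2+ R + (suc q + suc r)) + N + 0
    wrap = solve-∀
    last : ∀ N R → N + (1 + R) + 1 ≡ N + 2+ R + 0
    last = solve-∀
    size : ∀ R q r → 2+ (suc r + (q + suc R)) ≡ 2+ R + (suc q + suc r)
    size = solve-∀

  -- Column f lies in P. After the wrap the first arm uses up Q from the bottom; the odd number of
  -- columns brings it to the top, ready for the columns of P beyond f.
  arms-high : ∀ {f g S} N → suc (suc f + g) + suc S ≡ y → Odd (suc S) → ∀ h → Arms x y N (suc f) (suc h * y + suc (suc f + g))
  arms-high {f} {g} {S} N refl odd h = finish g refl
    where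
    open PermutationReasoning
    R = suc (suc f + g)
    P₀ = columns y N (suc h) [ 0 ]
    P₁ = columns y N (suc h) (range 1 (suc f))
    Q = columns y (N + R) h (range 0 (suc S))

    wrap : ∀ h f g S N → h * (suc (suc f + g) + suc S) + (N + suc (suc f + g)) + S + 1 ≡ suc h * (suc (suc f + g) + suc S) + N + 0
    wrap = solve-∀

    arm₁₀ : Trip x y N (N + R + 0) (P₀ ++ Q) (suc S) 0
    arm₁₀ = endsᵗ (+-identityʳ N) refl (expand (singleton 0) N (suc h) true refl)
      ◃ hop₁ (distance˘ 1 (wrap h f g S N)) ▹ endsᵗ refl (exit-odd odd)
          (expand (descending 0 S) (N + R) h false (length-range 0 (suc S)))

    arm₂ : Trip x y (N + suc f) _ P₁ f 0
    arm₂ = expand (descending 1 f) N (suc h) true (length-range 1 (suc f))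

    finish : ∀ g₀ → g₀ ≡ g → Arms x y N (suc f) (suc h * y + R)
    finish zero refl = arms arm₁₀ arm₂ (begin
        P₁ ++ P₀ ++ Q   ↭⟨ shifts P₁ P₀ ⟩
        P₀ ++ P₁ ++ Q   ≡⟨ trans (sym (++-assoc P₀ P₁ Q)) (cong (_++ Q)
            (trans (columns-++ y N (suc h) [ 0 ] (range 1 (suc f)))
            (cong (columns y N (suc h)) (cong (range 0) (cong suc (sym (+-identityʳ (suc f)))))))) ⟩
        columns y N (suc h) (range 0 R) ++ Q   ↭⟨ cover R (suc S) N h ⟩
        range N (suc h * y + R) ∎)
      (size f S)
      where
      size : ∀ f S → 2+ (suc S + f) ≡ suc (suc f + 0) + suc S
      size = solve-∀
    finish (suc g′) refl = arms
      (arm₁₀ ◃ hop₁ (distance˘ {N + R + 0} 1 (last N f g′)) ▹ expand (descending (2+ f) g′) N (suc h) true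
          (length-range (2+ f) (suc g′)))
      arm₂
      (begin
        P₁ ++ (P₀ ++ Q) ++ P₂   ↭⟨ ++⁺ˡ P₁ (↭-trans (↭-reflexive (++-assoc P₀ Q P₂)) (++⁺ˡ P₀ (++-comm Q P₂))) ⟩
        P₁ ++ P₀ ++ P₂ ++ Q     ↭⟨ shifts P₁ P₀ ⟩
        P₀ ++ P₁ ++ P₂ ++ Q     ≡⟨ trans (cong (P₀ ++_) (sym (++-assoc P₁ P₂ Q))) (sym (++-assoc P₀ (P₁ ++ P₂) Q)) ⟩
        (P₀ ++ P₁ ++ P₂) ++ Q   ≡⟨ cong (_++ Q) (trans (cong (P₀ ++_)
            (columns-++ y N (suc h) (range 1 (suc f)) (range (2+ f) (suc g′))))
                                     (trans (columns-++ y N (suc h) [ 0 ] (range 1 (suc f) ++ range (2+ f) (suc g′)))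
                                         (cong (λ p → columns y N (suc h) (0 ∷ p)) (sym (range-++ 1 (suc f) (suc g′)))))) ⟩
        columns y N (suc h) (range 0 R) ++ Q   ↭⟨ cover R (suc S) N h ⟩
        range N (suc h * y + R) ∎)
      (size f g′ S)
      where
      P₂ = columns y N (suc h) (range (2+ f) (suc g′))
      last : ∀ N f g′ → N + (2+ f + g′) + 1 ≡ N + suc (suc f + suc g′) + 0
      last = solve-∀
      size : ∀ f g′ S → 2+ (suc S + suc g′ + f) ≡ suc (suc f + suc g′) + suc S
      size = solve-∀

  -- The first vertices carry a walk with steps 1 and x, reflected so that it starts next to the top of column 0 and ends
  -- y below the top of column f.
  bridge : ∀ {n m δ f a b} → f + suc δ ≡ y → Tour x y 0 δ (range 0 (suc n)) a b 0 → Arms x y (suc n) f m →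
           ∃₂ λ s e → Trip x y s e (range 0 (suc n + m)) (a + pred y) b
  bridge {n} {m} {δ} {f} {a} {b} f+δ body (arms {a₁ = a₁} {a₂} {V₁} {V₂} T₁ T₂ perm size) = _ , _ ,
      recountᵗ (trans (eq a₁ a₂ a) (cong (λ z → a + pred z) size)) (+-identityʳ b)
        (permuteᵗ perm′ (reverseᵗ T₂ ◃ hopʸ (distance˘ y far) ▹ (_ , reverseᵀ (reflect body)) ◃ hop₁
            (distance {n} 1 (+-comm n 1)) ▹ T₁))
    where
    open PermutationReasoning
    eq : ∀ a₁ a₂ a → a₂ + (a + suc a₁) ≡ a + suc (a₁ + a₂)
    eq = solve-∀
    δ≤n : δ ≤ n
    δ≤n = end≤ body
    -- The reflected walk ends at n - δ, and y = f + δ + 1 is exactly its distance to the top of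
    -- column f.
    far : n ∸ δ + y ≡ suc n + f
    far = trans (cong (n ∸ δ +_) (trans (sym f+δ) (trans (+-suc f δ) (cong suc (+-comm f δ)))))
      (trans (+-suc (n ∸ δ) (δ + f)) (cong suc (trans (sym (+-assoc (n ∸ δ) δ f)) (cong (_+ f) (m∸n+n≡m δ≤n)))))
    perm′ : V₂ ++ range 0 (suc n) ++ V₁ ↭ range 0 (suc n + m)
    perm′ = begin
      V₂ ++ range 0 (suc n) ++ V₁   ↭⟨ shifts V₂ (range 0 (suc n)) ⟩
      range 0 (suc n) ++ V₂ ++ V₁   ↭⟨ ++⁺ˡ (range 0 (suc n)) perm ⟩
      range 0 (suc n) ++ range (suc n) m   ≡⟨ range-++ 0 (suc n) m ⟨
      range 0 (suc n + m) ∎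

even⊎odd : ∀ n → Even n ⊎ Odd n
even⊎odd zero = inj₁ (0 , refl)
even⊎odd (suc n) with even⊎odd n
... | inj₁ (k , refl) = inj₂ (k , refl)
... | inj₂ (k , refl) = inj₁ (suc k , cong suc (sym (+-suc k k)))

-- Standard realizations

Std : ℕ → ℕ → ℕ → ℕ → ℕ → ℕ → Set
Std x y n a b c = ∃[ e ] Tour x y 0 e (range 0 n) a b c

-- Turns a walk built with x as its long step into an index walk, where x is the middle kind of
-- step.
relabel : ∀ {x′ x y s e p a c} → Walk x′ x s e p a 0 c → Walk x y s e p a c 0
relabel stop        = stop
relabel (step₁ d w) = step₁ d (relabel w)
relabel (stepʸ d w) = stepˣ d (relabel w)

relabelᵗ : ∀ {x′ x y s e n a b} → Trip x′ x s e (range 0 n) a 0 → n ≡ suc (a + b) → Tour x y s e (range 0 n) a b 0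
relabelᵗ {n = n} {a} {b} t eq with pin t (length-range 0 n) (trans eq (cong (λ k → suc (k + b)) (sym (+-identityʳ a))))
... | p , w , p↭ = p , relabel w , p↭

module _ {x y : ℕ} where

  prepend-one : ∀ {e n a b c} → Tour x y 0 e (range 0 n) a b c → Tour x y 0 (suc e) (range 0 (suc n)) (suc a) b c
  prepend-one t = singleton 0 ◂ hop₁ refl ▸ translate 1 t

  prepend : ∀ j {e n a b c} → Tour x y 0 e (range 0 n) a b c → Tour x y 0 (j + e) (range 0 (j + n)) (j + a) b c
  prepend zero    t = t
  prepend (suc j) t = prepend-one (prepend j t)

  pinned : ∀ {e n a b c} → Trip x y 0 e (range 0 n) a b → n ≡ suc (a + b + c) → Std x y n a b c
  pinned {n = n} t eq = _ , pin t (length-range 0 n) eq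

  size : ∀ {s e n a b c} → Tour x y s e (range 0 n) a b c → n ≡ suc (a + b + c)
  size {n = n} t = trans (sym (length-range 0 n)) (tour-length t)

  concatenate : ∀ {n n′ a b c a′ b′ c′} → Std x y n a b c → Std x y n′ a′ b′ c′ →
                ∃[ m ] ∃₂ λ s e → Tour x y s e (range 0 m) (a + a′) (b + b′) (c + c′)
  concatenate {n} {n′} (_ , t) (_ , t′) with size t | size t′
  ... | refl | refl with reverseᵀ (reflect t) | permute (↭-reflexive (cong (λ m → range m n′) (+-identityʳ (pred n))))
      (endsᵀ (+-identityʳ (pred n)) refl (translate (pred n) t′))
  ... | p , w , p↭ | q , v , q↭ with walk-start v
  ... | q′ , refl = n + pred n′ , _ , _ , p ++ q′ , fuse w v ,
    ↭-trans (++⁺ p↭ (drop-∷ q↭))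
      (↭-reflexive (sym (range-++ 0 n (pred n′))))

  edges : ∀ {s e p a b c} → Walk x y s e p a b c → edgeLengths p ↭ mset a x b y c
  edges stop = ↭-refl
  edges (step₁ d w) with walk-start w | edges w
  ... | _ , refl | es = ↭-trans (↭-reflexive (cong (_∷ _) d)) (prep 1 es)
  edges (stepˣ {a = a} {b} {c} d w) with walk-start w | edges w
  ... | _ , refl | es = ↭-trans (↭-reflexive (cong (_∷ _) d)) (↭-trans (prep x es)
      (↭-sym (shift x (replicate a 1) (replicate b x ++ replicate c y))))
  edges (stepʸ {a = a} {b} {c} d w) with walk-start w | edges w
  ... | _ , refl | es = ↭-trans (↭-reflexive (cong (_∷ _) d)) (↭-trans (prep y es)
    (↭-trans (↭-sym (shift y (replicate a 1) (replicate b x ++ replicate c y)))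
        (++⁺ˡ (replicate a 1) (↭-sym (shift y (replicate b x) (replicate c y))))))

  realize : ∀ {s e n a b c} → Tour x y s e (range 0 n) a b c → LinearRealization (a + b + c + 1) (mset a x b y c)
  realize {n = n} {a} {b} {c} t@(p , w , p↭) = p ,
    ↭-trans p↭ (↭-reflexive (trans (range≡upTo n) (cong upTo (trans (size t) (+-comm 1 (a + b + c)))))) , edges w

  assemble : ∀ {n n′ a₁ b₁ a₂ b₂ a b c} → a₁ + a₂ ≡ a → b₁ + b₂ ≡ b → Std x y n a₁ b₁ 0 → Std x y n′ a₂ b₂ c →
             LinearRealization (a + b + c + 1) (mset a x b y c)
  assemble refl refl t t′ = realize (proj₂ (proj₂ (proj₂ (concatenate t t′))))

  all-ones-link : ∀ n → Link x y (suc n) (suc n) 0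
  all-ones-link n = subst (λ l → Link x y (suc n) l 0) (+-comm n 1) (link (ascending 0 n) (hop₁ (distance 1 (+-comm n 1))))

  all-ones-split : ∀ n → Split x y (2+ n) (2+ n) 0
  all-ones-split n with ascending {x} {y} 0 n
  ... | p , w , p↭ = subst (λ a → Split x y (2+ n) a 0) (+-comm n 2)
    (split w (hop₁ (distance 1 (+-comm n 1))) (↭-trans (++⁺ʳ [ suc n ] p↭) (↭-trans (++-comm (range 0 (suc n)) [ suc n ])
      (↭-trans (↭-reflexive (cong (_∷ range 0 (suc n)) (trans (cong suc (sym (*-identityʳ n)))
          (sym (+-identityʳ (suc n * 1)))))) (↭-sym (progression-last 0 1 (suc n)))))))

  ascending-columns : ∀ {R S′} → R + suc S′ ≡ y → Even R → ∀ h →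
                      Trip x y 0 (level y R h (turn (suc S′) true) + S′) (range 0 (suc h * y + R)) (pred y) 0
  ascending-columns {zero} {S′} refl _ h = permuteᵗ (↭-reflexive (cong (range 0) (sym (+-identityʳ (suc h * y)))))
      (only-Q (ascending 0 S′) h)
  ascending-columns {suc R′} {S′} refl even h = recountᵗ (sym (+-suc R′ S′)) refl
    (P-then-Q refl even (all-ones-link R′) (ascending 0 S′) h)

  descending-columns₀ : ∀ {y′} → y ≡ suc y′ → ∀ h → Trip x y 0 (level y 1 h (turn y true)) (range 0 (suc (suc h * y))) (pred y) 0
  descending-columns₀ {y′} refl h = endsᵗ refl (trans (cong (level y 1 h (turn y true) +_) (n∸n≡0 y′)) (+-identityʳ _))
      (only-Q˘ refl (ascending 0 y′) h)

  descending-columns : ∀ {R′ S′} → suc R′ + suc S′ ≡ y → Even (suc S′) → ∀ h →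
                       Trip x y 0 (level y 1 (suc h) (turn (suc R′) true)) (range 0 (suc (suc h * y + suc R′))) (pred y) 0
  descending-columns {R′} {S′} refl even h = endsᵗ refl (trans
      (cong (level y 1 (suc h) (turn (suc R′) true) +_) (n∸n≡0 R′)) (+-identityʳ _))
    (recountᵗ (+-comm (suc S′) R′) refl (Q-then-P refl even (all-ones-link S′) (ascending 0 R′) h))

  split-columns : ∀ {R S′} → 2+ R + suc S′ ≡ y → Even (suc S′) → ∀ h → ∃[ e ] Trip x y 0 e (range 0 (suc (suc h * y + 2+ R))) y 0
  split-columns {R} {S′} refl even h with Q-then-split-P refl even (all-ones-link S′) (all-ones-split R) h
  ... | e , t = e , recountᵗ (+-comm (suc S′) (2+ R)) refl t

-- Parity and division with remainder

even+even : ∀ {m n} → Even m → Even n → Even (m + n)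
even+even (k , refl) (l , refl) = k + l , eq k l
  where
  eq : ∀ k l → k + k + (l + l) ≡ k + l + (k + l)
  eq = solve-∀

even+odd : ∀ {m n} → Even m → Odd n → Odd (m + n)
even+odd (k , refl) (l , refl) = k + l , eq k l
  where
  eq : ∀ k l → k + k + suc (l + l) ≡ suc (k + l + (k + l))
  eq = solve-∀

odd+odd : ∀ {m n} → Odd m → Odd n → Even (m + n)
odd+odd (k , refl) (l , refl) = suc (k + l) , eq k l
  where
  eq : ∀ k l → suc (k + k) + suc (l + l) ≡ suc (k + l) + suc (k + l)
  eq = solve-∀

odd+even : ∀ {m n} → Odd m → Even n → Odd (m + n)
odd+even {m} {n} o e = subst Odd (+-comm n m) (even+odd e o)

even-odd-absurd : ∀ {n} → Even n → Odd n → ⊥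
even-odd-absurd (k , refl) (l , eq) = absurd k l eq
  where
  absurd : ∀ k l → k + k ≡ suc (l + l) → ⊥
  absurd (suc k) zero    eq with trans (sym (+-suc k k)) (suc-injective eq)
  ... | ()
  absurd (suc k) (suc l) eq = absurd k l (suc-injective (trans (sym (+-suc k k)) (trans (suc-injective eq) (cong suc (+-suc l l)))))

even-suc : ∀ {n} → Even (suc n) → Odd n
even-suc {n} e with even⊎odd n
... | inj₁ e′ = ⊥-elim (even-odd-absurd e (odd+even (0 , refl) e′))
... | inj₂ o = o

odd-suc : ∀ {n} → Odd (suc n) → Even n
odd-suc (k , eq) = k , suc-injective eq

suc-odd : ∀ {n} → Odd n → Even (suc n)
suc-odd = odd+odd (0 , refl)

even∸even : ∀ {m n} → Even m → Even (m + n) → Even n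
even∸even {n = n} e e′ with even⊎odd n
... | inj₁ e″ = e″
... | inj₂ o = ⊥-elim (even-odd-absurd e′ (even+odd e o))

odd∸odd : ∀ {m n} → Odd m → Odd (m + n) → Even n
odd∸odd {n = n} o o′ with even⊎odd n
... | inj₁ e = e
... | inj₂ o″ = ⊥-elim (even-odd-absurd (odd+odd o o″) o′)

odd∸even : ∀ {m n} → Even m → Odd (m + n) → Odd n
odd∸even {n = n} e o with even⊎odd n
... | inj₁ e′ = ⊥-elim (even-odd-absurd (even+even e e′) o)
... | inj₂ o′ = o′

divide : ∀ m n → ∃₂ λ r h → r < suc m × n ≡ r + h * suc m
divide m n = n % suc m , n / suc m , m%n<n n (suc m) , m≡m%n+[m/n]*n n (suc m)

gap : ∀ {m n} → m < n → ∃[ k ] m + suc k ≡ n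
gap {m} m<n with m≤n⇒∃[o]m+o≡n m<n
... | k , eq = k , trans (+-suc m k) eq

-- Realizations with the steps 1 and m

Mono : ℕ → ℕ → ℕ → ℕ → Set
Mono x m a c = ∃[ e ] Tour x m 0 e (range 0 (suc (a + c))) a 0 c

-- For even m the end is recorded because a bridge needs it to lie in the first row, at an odd position.
mono-end : ∀ {x m′} r h → r < suc m′ → Even r ⊎ r ≡ 1 ⊎ Even (suc m′) →
           ∃[ e ] Tour x (suc m′) 0 e (range 0 (suc (m′ + (r + h * suc m′)))) m′ 0 (r + h * suc m′) ×
               (Even (suc m′) → Odd e × e ≤ m′)
mono-end {x} {m′} r h r<m cond with gap r<m | even⊎odd r
... | S , R+S | inj₁ even = _ , pin (permuteᵗ (↭-reflexive (cong (range 0) (eq m′ h r))) (ascending-columns R+S even h))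
    (length-range 0 _) (eq′ m′ (r + h * suc m′)) , ending
  where
  eq : ∀ m h r → suc h * suc m + r ≡ suc (m + (r + h * suc m))
  eq = solve-∀
  eq′ : ∀ m c → suc (m + c) ≡ suc (m + 0 + c)
  eq′ = solve-∀
  ending : Even (suc m′) → Odd (level (suc m′) r h (turn (suc S) true) + S) × level (suc m′) r h (turn (suc S) true) + S ≤ m′
  ending e = subst (λ z → Odd z × z ≤ m′)
    (sym (trans (exit-even (even∸even even (subst Even (sym R+S) e))) (suc-injective (trans (sym (+-suc r S)) R+S))))
        (even-suc e , ≤-refl)
-- Residue 1: the initial y-step removes vertex 0 and leaves columns of equal height.
mono-end {x} {m′} (suc zero) h r<m cond | S , R+S | inj₂ odd =
  _ , pin (permuteᵗ (↭-reflexive (cong (range 0) (eq m′ h))) (descending-columns₀ refl h)) (length-range 0 _)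
      (eq′ m′ (suc (h * suc m′))) , ending
  where
  eq : ∀ m h → suc (suc h * suc m) ≡ suc (m + suc (h * suc m))
  eq = solve-∀
  eq′ : ∀ m c → suc (m + c) ≡ suc (m + 0 + c)
  eq′ = solve-∀
  ending : Even (suc m′) → Odd (level (suc m′) 1 h (turn (suc m′) true)) × level (suc m′) 1 h (turn (suc m′) true) ≤ m′
  ending e = subst (λ z → Odd z × z ≤ m′) (trans (sym (exit-even {e = 0} e)) (+-identityʳ _)) ((0 , refl) , ≤-pred r<m)
-- Without vertex 0 the block P has r - 1 columns, and Q has m - r + 1, an even number since m is
-- even and r odd.
mono-end {x} {m′} (2+ R) h r<m cond | S , R+S | inj₂ odd with cond
... | inj₁ even = ⊥-elim (even-odd-absurd even odd)
... | inj₂ (inj₁ ())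
... | inj₂ (inj₂ e) =
  _ , pin (permuteᵗ (↭-reflexive (cong (range 0) (eq m′ h R)))
      (descending-columns (trans (cong suc (+-suc R (suc S))) R+S) evenS h)) (length-range 0 _) (eq′ m′ (2+ R + h * suc m′)) ,
  λ _ → subst (λ z → Odd z × z ≤ m′) (trans (sym (exit-even {e = 0} (odd-suc odd))) (+-identityʳ _))
      ((0 , refl) , ≤-trans (s≤s z≤n) (≤-pred r<m))
  where
  eq : ∀ m h R → suc (suc h * suc m + suc R) ≡ suc (m + (2+ R + h * suc m))
  eq = solve-∀
  eq′ : ∀ m c → suc (m + c) ≡ suc (m + 0 + c)
  eq′ = solve-∀
  evenS : Even (2+ S)
  evenS = even∸even (odd-suc odd) (subst Even (sym (trans (cong suc (+-suc R (suc S))) R+S)) e)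

mono-prepend : ∀ {x m a c} j → Mono x m a c → Mono x m (j + a) c
mono-prepend {c = c} j (e , t) = _ , permute (↭-reflexive (cong (range 0)
    (trans (+-suc j _) (cong suc (sym (+-assoc j _ c)))))) (prepend j t)

mono-short : ∀ {x m′} a r h → m′ ≤ a → r < suc m′ → Even r ⊎ r ≡ 1 ⊎ Even (suc m′) → Mono x (suc m′) a (r + h * suc m′)
mono-short {m′ = m′} a r h m≤a r<m cond with mono-end r h r<m cond
... | e , t , _ = subst (λ a → Mono _ _ a _) (m∸n+n≡m m≤a) (mono-prepend (a ∸ m′) (e , t))

-- Beyond the cases of `mono-end` only odd m with an odd residue above 1 is left. There a column is
-- split, at the price of one more 1.
mono : ∀ {x m′} a c → suc m′ ≤ a → Mono x (suc m′) a c
mono {x} {m′} a c m≤a with divide m′ c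
... | r , h , r<m , refl with even⊎odd r | even⊎odd (suc m′)
... | inj₁ even | _ = mono-short a r h (≤-trans (n≤1+n m′) m≤a) r<m (inj₁ even)
... | inj₂ odd | inj₁ even = mono-short a r h (≤-trans (n≤1+n m′) m≤a) r<m (inj₂ (inj₂ even))
... | inj₂ (zero , refl) | inj₂ _ = mono-short a 1 h (≤-trans (n≤1+n m′) m≤a) r<m (inj₂ (inj₁ refl))
... | inj₂ (suc k , refl) | inj₂ odd with gap r<m
... | S , R+S with split-columns {x} R+S (odd∸odd (suc k , refl) (subst Odd (sym R+S) odd)) h
... | e , t = subst (λ a → Mono _ _ a _) (m∸n+n≡m m≤a) (mono-prepend (a ∸ suc m′)
    (e , pin (permuteᵗ (↭-reflexive (cong (range 0) (eq m′ h k))) t) (length-range 0 _)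
        (eq′ m′ (suc (suc k + suc k) + h * suc m′))))
  where
  eq : ∀ m h k → suc (suc h * suc m + 2+ (k + suc k)) ≡ suc (suc m + (suc (suc k + suc k) + h * suc m))
  eq = solve-∀
  eq′ : ∀ m c → suc (suc m + c) ≡ suc (suc m + 0 + c)
  eq′ = solve-∀

-- Every residue mod 3 is even or 1, so the expensive case never arises.
mono₃ : ∀ {x} a c → 2 ≤ a → Mono x 3 a c
mono₃ a c 2≤a with divide 2 c
... | 0 , h , r<3 , refl = mono-short a 0 h 2≤a r<3 (inj₁ (0 , refl))
... | 1 , h , r<3 , refl = mono-short a 1 h 2≤a r<3 (inj₂ (inj₁ refl))
... | 2 , h , r<3 , refl = mono-short a 2 h 2≤a r<3 (inj₁ (1 , refl))
... | 2+ (suc r) , h , s≤s (s≤s (s≤s ())) , refl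

-- Joining the two parts: the bounds x + y - 1 and x + y - 2

Standard : ℕ → ℕ → ℕ → ℕ → ℕ → Set
Standard x y a b c = ∃[ n ] Std x y n a b c

of-x : ∀ {x′ x y a b} → Mono x′ x a b → Standard x y a b 0
of-x (e , p , w , p↭) = _ , e , p , relabel w , p↭

of-y : ∀ {x y a c} → Mono x y a c → Standard x y a 0 c
of-y (e , t) = _ , e , t

module _ {x y : ℕ} where

  -- All ones that the y-part does not use go to the {1, x}-part, which accepts any number from `k`
  -- on.
  complete : ∀ {a₂ b₂ c a b₁ b} k → k + a₂ ≤ a → b₁ + b₂ ≡ b → (∀ a₁ → k ≤ a₁ → Standard x y a₁ b₁ 0) → Standard x y a₂ b₂ c →
             LinearRealization (a + b + c + 1) (mset a x b y c)
  complete {a₂} {a = a} k k+a₂≤a b≡ f t = assemble (m∸n+n≡m (≤-trans (m≤n+m a₂ k) k+a₂≤a)) b≡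
      (proj₂ (f (a ∸ a₂) (m+n≤o⇒m≤o∸n k k+a₂≤a))) (proj₂ t)

  -- The walk climbs to g, jumps to g + x and comes down to g + 1. Its last hop, the one counted
  -- twice, is a 1-step, so the x-step stays single.
  one-x-split : ∀ g {x″} → x ≡ 2+ x″ → Split x y (suc g + x) (g + x″ + 2) 1
  one-x-split g {x″} refl with ascending {x} {y} 0 g ◂ hopˣ (distance x
      (trans (+-suc g (suc x″)) (cong suc (+-suc g x″)))) ▸ descending (2+ g) x″
  ... | p , w , p↭ = split w (hop₁ (distance˘ {2+ g} {suc g} 1 (+-comm (suc g) 1))) (begin
      p ++ [ suc g ]                                          ↭⟨ ++-comm p [ suc g ] ⟩
      suc g ∷ p                                               ↭⟨ prep (suc g) p↭ ⟩
      suc g ∷ range 0 (suc g) ++ range (2+ g) (suc x″)        ↭⟨ ↭-sym (shift (suc g) (range 0 (suc g)) (range (2+ g) (suc x″))) ⟩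
      range 0 (suc g) ++ range (suc g) (2+ x″)                ≡⟨ range-++ 0 (suc g) (2+ x″) ⟨
      range 0 (suc g + (2+ x″))                               ∎)
    where open PermutationReasoning

-- For an expensive residue an x-step replaces the additional 1. If r ≤ x it opens the path and
-- leads to the wrap; otherwise P has more than x columns and the x-step fits into its index walk.
one-x : ∀ {x′ y′} r h → Odd (suc x′) → Odd (suc y′) → Odd r → 1 < suc x′ → suc x′ < suc y′ → r < suc y′ →
        Standard (suc x′) (suc y′) y′ 1 (r + h * suc y′)
one-x {x′} {y′} zero h oˣ oʸ oʳ 1<x x<y r<y = ⊥-elim (even-odd-absurd (0 , refl) oʳ)
one-x {x′} {y′} (suc r) h oˣ oʸ oʳ 1<x x<y r<y with ≤-<-connex (suc r) (suc x′)
... | inj₁ r≤x with m≤n⇒∃[o]m+o≡n r≤x | gap x<y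
... | g , r+g | M , x+M with wrap-around oʳ (odd∸odd oʳ (subst Odd (sym r+g) oˣ)) r+g x+M (ascending 0 M) h
... | e , t = _ , pinned (recountᵗ (trans (sym (+-suc x′ M)) (suc-injective x+M)) refl t) (eq y′ r h)
  where
  eq : ∀ y r h → suc (suc h * suc y + suc r) ≡ suc (y + 1 + (suc r + h * suc y))
  eq = solve-∀
one-x {suc x″} {y′} (suc r) h oˣ oʸ oʳ 1<x x<y r<y | inj₂ x<r with gap x<r | gap r<y
... | g , x+g | S , r+S with Q-then-split-P r+S (odd∸odd oʳ (subst Odd (sym r+S) oʸ)) (all-ones-link S)
      (subst (λ n → Split (2+ x″) (suc y′) n (g + x″ + 2) 1) (trans (+-comm (suc g) (2+ x″)) x+g) (one-x-split g {x″} refl)) h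
... | e , t = _ , pinned (recountᵗ ones refl t) (eq y′ r h)
  where
  eq : ∀ y r h → suc (suc h * suc y + suc r) ≡ suc (y + 1 + (suc r + h * suc y))
  eq = solve-∀
  eq₁ : ∀ S g x″ → suc S + (g + x″ + 2) ≡ suc (x″ + suc g) + suc S
  eq₁ = solve-∀
  ones : suc S + (g + x″ + 2) ≡ y′
  ones = trans (eq₁ S g x″) (trans (cong (_+ suc S) (suc-injective x+g)) (suc-injective r+S))
one-x {zero} _ _ _ _ _ (s≤s ()) _ _ | inj₂ _

module _ {x′ y′ : ℕ} (1<x : 1 < suc x′) (x<y : suc x′ < suc y′) where

  private
    x = suc x′
    y = suc y′

  short-x : ∀ r h → r < x → Even r ⊎ r ≡ 1 ⊎ Even x → ∀ a → x′ ≤ a → Standard x y a (r + h * x) 0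
  short-x r h r<x cond a x′≤a = of-x {0} (mono-short a r h x′≤a r<x cond)

  long-x : ∀ b a → x ≤ a → Standard x y a b 0
  long-x b a x≤a = of-x {0} (mono a b x≤a)

  case₁ : ∀ a b c → x′ + y ≤ a → LinearRealization (a + b + c + 1) (mset a x b y c)
  case₁ a b c bound with divide x′ b | divide y′ c
  ... | r , h , r<x , refl | s , k , s<y , refl with even⊎odd x | even⊎odd y
  ... | inj₁ e | _ = complete x′ bound (+-identityʳ _) (short-x r h r<x (inj₂ (inj₂ e))) (of-y (mono y (s + k * y) ≤-refl))
  ... | inj₂ _ | inj₁ e = complete x (subst (_≤ a) (+-suc x′ y′) bound) (+-identityʳ _) (long-x (r + h * x))
      (of-y (mono-short y′ s k ≤-refl s<y (inj₂ (inj₂ e))))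
  ... | inj₂ oˣ | inj₂ oʸ with even⊎odd r | even⊎odd s
  ... | inj₁ e | _ = complete x′ bound (+-identityʳ _) (short-x r h r<x (inj₁ e)) (of-y (mono y (s + k * y) ≤-refl))
  ... | inj₂ _ | inj₁ e = complete x (subst (_≤ a) (+-suc x′ y′) bound) (+-identityʳ _) (long-x (r + h * x))
      (of-y (mono-short y′ s k ≤-refl s<y (inj₁ e)))
  case₁ a b c bound | zero , h , r<x , refl | s , k , s<y , refl | inj₂ oˣ | inj₂ oʸ | inj₂ oʳ | inj₂ oˢ = ⊥-elim
      (even-odd-absurd (0 , refl) oʳ)
  -- Both parts are expensive. Giving one x-step to the y-part makes the residue of the x-part even
  -- and saves a 1 in each.
  case₁ a b c bound | suc r , h , r<x , refl | s , k , s<y , refl | inj₂ oˣ | inj₂ oʸ | inj₂ oʳ | inj₂ oˢ =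
    complete x′ (≤-trans (+-monoʳ-≤ x′ (n≤1+n y′)) bound) (+-comm _ 1)
        (short-x r h (<-trans (n<1+n r) r<x) (inj₁ (odd-suc oʳ))) (one-x s k oˣ oʸ oˢ 1<x x<y s<y)

  -- The end δ of the {1, x}-walk is odd and at most x - 1, so f = y - 1 - δ exists and is odd. That
  -- is the parity both kinds of arms require.
  bridge-case : ∀ b s k → Even x → Odd y → Odd (3 + s) → 3 + s < y →
                let c = 3 + s + k * y in LinearRealization (x′ + y′ + b + c + 1) (mset (x′ + y′) x b y c)
  bridge-case b s k eˣ oʸ oˢ s<y with divide x′ b
  ... | r , h , r<x , refl with mono-end {0} r h r<x (inj₂ (inj₂ eˣ))
  ... | δ , (p , w , p↭) , ending with ending eˣ
  ... | (j , refl) , δ≤ with m≤n⇒∃[o]m+o≡n (≤-trans δ≤ (<⇒≤ (≤-pred x<y)))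
  ... | f , δ+f = finish (proj₂ (proj₂ (bridge (trans (+-comm f (2+ (j + j))) (cong suc δ+f)) (p , relabel w , p↭)
      (both (≤-<-connex (2+ s) f)))))
    where
    -- The bridge itself takes one y-step, so the block P has one column less than the residue 3 +
    -- s.
    evenR : Even (2+ s)
    evenR = odd-suc oˢ
    oddf : Odd f
    oddf = odd∸even (suc-odd (j , refl)) (subst Odd (cong suc (sym δ+f)) oʸ)
    R<y : 2+ s < y
    R<y = <-trans (n<1+n _) s<y
    eq₁ : ∀ R q j → R + (suc q + suc (j + j)) ≡ suc (suc (j + j) + (R + q))
    eq₁ = solve-∀
    both : 2+ s ≤ f ⊎ f < 2+ s → Arms x y (suc (x′ + (r + h * x))) f (suc k * y + 2+ s)
    both (inj₁ R≤f) with m≤n⇒∃[o]m+o≡n R≤f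
    ... | q , R+q = subst (λ f → Arms x y _ f (suc k * y + 2+ s)) R+q
      (arms-low _ (trans (eq₁ (2+ s) q j) (trans (cong (λ f → 2+ (j + j) + f) R+q) (cong suc δ+f)))
          (suc-odd (odd∸even evenR (subst Odd (sym R+q) oddf))) k)
    both (inj₂ f<R) with gap f<R | gap R<y
    both (inj₂ f<R) | g , f+g | S , R+S with oddf
    ... | l , refl = subst (λ R → Arms x y (suc (x′ + (r + h * x))) f (suc k * y + R)) R≡
        (arms-high _ (trans (cong (_+ suc S) R≡) R+S)
        (odd∸even evenR (subst Odd (sym R+S) oʸ)) k)
      where
      R≡ : suc (suc (l + l) + g) ≡ 2+ s
      R≡ = trans (sym (+-suc f g)) f+g
    eq : ∀ x′ b k y′ s → suc (x′ + b) + (suc k * suc y′ + 2+ s) ≡ suc (x′ + y′ + b + (3 + s + k * suc y′))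
    eq = solve-∀
    finish : ∀ {u v} → Trip x y u v (range 0 (suc (x′ + (r + h * x)) + (suc k * y + 2+ s))) (x′ + y′) (r + h * x) → _
    finish t = realize (pin t (length-range 0 _) (eq x′ (r + h * x) k y′ s))

  case₂ : ∀ a b c → x′ + y′ ≤ a → Even x → LinearRealization (a + b + c + 1) (mset a x b y c)
  case₂ a b c bound eˣ with divide x′ b | divide y′ c
  ... | r , h , r<x , refl | s , k , s<y , refl with even⊎odd y | even⊎odd s
  ... | inj₁ e | _ = complete x′ bound (+-identityʳ _) (short-x r h r<x (inj₂ (inj₂ eˣ)))
      (of-y (mono-short y′ s k ≤-refl s<y (inj₂ (inj₂ e))))
  ... | inj₂ _ | inj₁ e = complete x′ bound (+-identityʳ _) (short-x r h r<x (inj₂ (inj₂ eˣ)))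
      (of-y (mono-short y′ s k ≤-refl s<y (inj₁ e)))
  case₂ a b c bound eˣ | r , h , r<x , refl | 1 , k , s<y , refl | inj₂ oʸ | inj₂ oˢ =
    complete x′ bound (+-identityʳ _) (short-x r h r<x (inj₂ (inj₂ eˣ))) (of-y (mono-short y′ 1 k ≤-refl s<y (inj₂ (inj₁ refl))))
  case₂ a b c bound eˣ | r , h , r<x , refl | 2 , k , s<y , refl | inj₂ oʸ | inj₂ oˢ = ⊥-elim (even-odd-absurd (1 , refl) oˢ)
  case₂ a b c bound eˣ | r , h , r<x , refl | 0 , k , s<y , refl | inj₂ oʸ | inj₂ oˢ = ⊥-elim (even-odd-absurd (0 , refl) oˢ)
  case₂ a b c bound eˣ | r , h , r<x , refl | 2+ (suc s) , k , s<y , refl | inj₂ oʸ | inj₂ oˢ with m≤n⇒m<n∨m≡n bound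
  ... | inj₁ bound′ = case₁ a (r + h * x) (3 + s + k * y) (subst (_≤ a) (sym (+-suc x′ y′)) bound′)
  ... | inj₂ refl = bridge-case (r + h * x) s k eˣ oʸ oˢ s<y

case₂-three : ∀ {y′} a b c → 3 < suc y′ → 2 + y′ ≤ a → LinearRealization (a + b + c + 1) (mset a 3 b (suc y′) c)
case₂-three {y′} a b c 3<y bound with divide y′ c
... | s , k , s<y , refl with even⊎odd (suc y′) | even⊎odd s
... | inj₁ e | _ = complete 2 bound (+-identityʳ b) (λ a₁ le → of-x {0} (mono₃ a₁ b le))
    (of-y (mono-short y′ s k ≤-refl s<y (inj₂ (inj₂ e))))
... | inj₂ _ | inj₁ e = complete 2 bound (+-identityʳ b) (λ a₁ le → of-x {0} (mono₃ a₁ b le))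
    (of-y (mono-short y′ s k ≤-refl s<y (inj₁ e)))
-- With b = 0 there is no x-step to hand over, but also no {1, x}-part to pay for.
case₂-three {y′} a zero c 3<y bound | s , k , s<y , refl | inj₂ oʸ | inj₂ oˢ =
  realize (proj₂ (mono {3} a (s + k * suc y′) (≤-trans (n≤1+n _) bound)))
case₂-three {y′} a (suc b) c 3<y bound | s , k , s<y , refl | inj₂ oʸ | inj₂ oˢ =
  complete 2 bound (+-comm b 1) (λ a₁ le → of-x {0} (mono₃ a₁ b le)) (one-x s k (1 , refl) oʸ oˢ (s≤s (s≤s z≤n)) 3<y s<y)

-- Index walks with mostly x-steps

link-total : ∀ {x y K l m} → Link x y K l m → l + m ≡ K
link-total (link {a = a} {b} t hop) = trans (lemma a b hop) (sym (size t))
  where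
  lemma : ∀ {x y u w i j} a b → Hop x y u w i j 0 → a + i + (b + j) ≡ suc (a + b + 0)
  lemma a b (hop₁ _) = eq a b
    where
    eq : ∀ a b → a + 1 + (b + 0) ≡ suc (a + b + 0)
    eq = solve-∀
  lemma a b (hopˣ _) = eq a b
    where
    eq : ∀ a b → a + 0 + (b + 1) ≡ suc (a + b + 0)
    eq = solve-∀

split-total : ∀ {x y n a b} → Split x y n a b → a + b ≡ n
split-total {n = n} (split {w′ = w′} {p} {a} {b} v hop perm) = trans (lemma a b hop)
    (trans (cong suc (sym (walk-length v))) (trans (+-comm 1 (length p))
        (trans (sym (length-++ p)) (trans (↭-length perm) (length-range 0 n)))))
  where
  lemma : ∀ {x y u w i j} a b → Hop x y u w i j 0 → a + (i + i) + (b + (j + j)) ≡ suc (suc (a + b + 0))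
  lemma a b (hop₁ _) = eq a b
    where
    eq : ∀ a b → a + 2 + (b + 0) ≡ suc (suc (a + b + 0))
    eq = solve-∀
  lemma a b (hopˣ _) = eq a b
    where
    eq : ∀ a b → a + 0 + (b + 2) ≡ suc (suc (a + b + 0))
    eq = solve-∀

prepend-split : ∀ {x y n a b} j → Split x y n a b → Split x y (j + n) (j + a) b
prepend-split zero    t = t
prepend-split (suc j) t = one-more (prepend-split j t)
  where
  one-more : ∀ {x y n a b} → Split x y n a b → Split x y (suc n) (suc a) b
  one-more {n = n} (split {w′ = w′} {p} v hop perm) = split
    (step₁ refl (map-walk {Q = λ _ → ⊤} {f = suc} (λ _ _ → refl) (All.universal (λ _ → tt) p) v))
    (hop-isometry refl hop)
    (prep 0 (↭-trans (↭-reflexive (sym (map-++ suc p [ w′ ]))) (↭-trans (map⁺ suc perm) (↭-reflexive (map-+-progression 1 0 1 n)))))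

-- A split walk repeats its last hop, so fewest 1-steps are used if the last hop is known to be a y-step.
record Trip⁻ (x y s : ℕ) (V : List ℕ) (a b : ℕ) : Set where
  constructor trip⁻
  field
    {w w′ c} : ℕ
    {p}      : List ℕ
    walk     : Walk x y s w p a b c
    last     : ∣ w - w′ ∣ ≡ y
    perm     : p ++ [ w′ ] ↭ V

module _ {x y : ℕ} where

  join⁻ : ∀ {s e s′ V V′ a b a′ b′ i j k} → Trip x y s e V a b → Hop x y e s′ i j k → Trip⁻ x y s′ V′ a′ b′ →
          Trip⁻ x y s (V ++ V′) (a + (i + a′)) (b + (j + b′))
  join⁻ (_ , p , w , p↭) h (trip⁻ {w′ = w′} {p = q} v d q↭) = trip⁻ (glue w h v) d
    (↭-trans (↭-reflexive (++-assoc p q [ w′ ])) (++⁺ p↭ q↭))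

  permute⁻ : ∀ {s V V′ a b} → V ↭ V′ → Trip⁻ x y s V a b → Trip⁻ x y s V′ a b
  permute⁻ V↭ (trip⁻ w d p↭) = trip⁻ w d (↭-trans p↭ V↭)

  directed⁻ : ∀ β h d j → Trip⁻ x y (level y β (suc h) d + j) (progression (β + j) y (2+ h)) 0 0
  directed⁻ β h true j with column {x} {y} (β + j) h
  ... | p , w , p↭ = trip⁻ w (distance y (+-comm (h * y + (β + j)) y))
    (↭-trans (++-comm p _) (↭-trans (prep _ p↭) (↭-trans (↭-reflexive
        (cong (_∷ progression (β + j) y (suc h)) (sym (+-assoc y (h * y) (β + j))))) (↭-sym (progression-last (β + j) y (suc h))))))
  directed⁻ β h false j with reverseᵀ (endsᵀ refl (eq h y β j) (column {x} {y} (y + (β + j)) h))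
    where
    eq : ∀ h y β j → h * y + (y + (β + j)) ≡ suc h * y + β + j
    eq = solve-∀
  ... | p , w , p↭ = trip⁻ w (distance˘ y (+-comm (β + j) y)) (↭-trans (++-comm p _) (prep (β + j) p↭))

  expand-walk⁻ : ∀ {s e p a b} → Walk x y s e p a b 0 → ∀ β h d → Trip⁻ x y (level y β (suc h) d + s) (columns y β (suc h) p) a b
  expand-walk⁻ stop β h d = permute⁻ (↭-reflexive (sym (++-identityʳ _))) (directed⁻ β h d _)
  expand-walk⁻ (step₁ δ w) β h d = join⁻ (directed β (suc h) d _) (hop-level (level y β (suc h) (not d)) (hop₁ δ))
      (expand-walk⁻ w β h (not d))
  expand-walk⁻ (stepˣ δ w) β h d = join⁻ (directed β (suc h) d _) (hop-level (level y β (suc h) (not d)) (hopˣ δ))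
      (expand-walk⁻ w β h (not d))

  expand⁻ : ∀ {s e V a b} → Tour x y s e V a b 0 → ∀ β h d → Trip⁻ x y (level y β (suc h) d + s) (columns y β (suc h) V) a b
  expand⁻ (p , w , p↭) β h d = permute⁻ (columns-↭ {x} p↭) (expand-walk⁻ w β h d)

  ascending-columns⁻ : ∀ {R S′} → R + suc S′ ≡ y → Even R → ∀ h → Trip⁻ x y 0 (range 0 (2+ h * y + R)) (pred y) 0
  ascending-columns⁻ {zero} {S′} refl _ h = permute⁻ (cover 0 y 0 (suc h)) (expand⁻ (ascending 0 S′) 0 h true)
  ascending-columns⁻ {suc R′} {S′} refl even h = permute⁻ (cover R S 0 (suc h))
      ((join⁻ (endsᵗ refl (exit-even even) (expand (ascending 0 R′) 0 (2+ h) true (length-range 0 R)))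
        (hop₁ (distance 1 (trans (+-comm R′ 1) (sym (+-identityʳ R))))) (expand⁻ (ascending 0 S′) R h true)))
    where
    R = suc R′
    S = suc S′

  descending-columns₀⁻ : ∀ {y′} → y ≡ suc y′ → ∀ h → Trip⁻ x y 0 (range 0 (suc (2+ h * y))) (pred y) 0
  descending-columns₀⁻ {y′} refl h = permute⁻ (prep 0 (↭-trans (cover 0 y 1 (suc h))
      (↭-reflexive (cong (range 1) (+-identityʳ (2+ h * y))))))
    (join⁻ (_ , singleton 0) (hopʸ refl) (expand⁻ (descending 0 y′) 1 h true))

split-of : ∀ {z x y n n′ a} → n ≡ n′ → Trip⁻ z x 0 (range 0 n) a 0 → ∃[ b ] Split x y n′ a b
split-of {y = y} {n = n} {a = a} refl (trip⁻ {c = c} v d perm) = c + 2 , subst (λ a → Split _ y n a (c + 2))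
    (+-identityʳ a) (split (relabel v) (hopˣ d) perm)

final-hop : ∀ {x y u v e p a b i j} → Hop x y u v i j 0 → Walk x y v e p a b 0 →
            ∃[ w ] ∃[ q ] ∃₂ λ a′ b′ → ∃₂ λ i′ j′ → Walk x y u w q a′ b′ 0 × Hop x y w e i′ j′ 0 × q ++ [ e ] ≡ u ∷ p × a′
                + i′ ≡ i + a × b′ + j′ ≡ j + b
final-hop {u = u} h stop = u , [ u ] , _ , _ , _ , _ , stop , h , refl , sym (+-identityʳ _) , sym (+-identityʳ _)
final-hop {i = i} {j} h (step₁ d v) with final-hop (hop₁ d) v
... | w , q , a′ , b′ , i′ , j′ , v′ , h′ , eq , eqᵃ , eqᵇ = w , _ , _ , _ , i′ , j′ , move h v′ , h′ , cong (_ ∷_) eq ,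
      trans (+-assoc i a′ i′) (cong (i +_) eqᵃ) , trans (+-assoc j b′ j′) (cong (j +_) eqᵇ)
final-hop {i = i} {j} h (stepˣ d v) with final-hop (hopˣ d) v
... | w , q , a′ , b′ , i′ , j′ , v′ , h′ , eq , eqᵃ , eqᵇ = w , _ , _ , _ , i′ , j′ , move h v′ , h′ , cong (_ ∷_) eq ,
      trans (+-assoc i a′ i′) (cong (i +_) eqᵃ) , trans (+-assoc j b′ j′) (cong (j +_) eqᵇ)

-- Doubling the last hop adds a 1 only if that hop is a 1-step.
split-last : ∀ {x y e n a b} → Tour x y 0 e (range 0 (2+ n)) a b 0 → ∃₂ λ τ β → Split x y (2+ n) τ β × a ≤ τ × τ ≤ suc a
split-last {x} {y} {e} {n} {a} {b} (p , v , p↭) with from v p↭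
  where
  from : ∀ {p a b} → Walk x y 0 e p a b 0 → p ↭ range 0 (2+ n) →
         ∃[ w ] ∃[ q ] ∃₂ λ a′ b′ → ∃₂ λ i j → Walk x y 0 w q a′ b′ 0 × Hop x y w e i j 0 × q ++ [ e ] ≡ p × a′ + i ≡ a × b′ + j ≡ b
  from stop p↭ with ↭-length p↭
  ... | ()
  from (step₁ d v) _ = final-hop (hop₁ d) v
  from (stepˣ d v) _ = final-hop (hopˣ d) v
... | w , q , a′ , b′ , i , j , v′ , h , refl , refl , _ = _ , _ , split v′ h p↭ ,
    +-monoʳ-≤ a′ (m≤m+n i i) , ≤-trans (≤-reflexive (sym (+-assoc a′ i i)))
        (≤-trans (+-monoʳ-≤ (a′ + i) (at-most-one h)) (≤-reflexive (+-comm (a′ + i) 1)))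
  where
  at-most-one : ∀ {x y u w i j k} → Hop x y u w i j k → i ≤ 1
  at-most-one (hop₁ _) = ≤-refl
  at-most-one (hopˣ _) = z≤n
  at-most-one (hopʸ _) = z≤n

-- For K < x all steps are 1. If x divides K, the column walk ends at K - 1 because x is odd.
-- Otherwise r ones precede a column walk on 1 + (h + 1)x vertices that ends x before K; as r ≤ x -
-- 2, this takes at most 2x - 3 ones, the worst case.
find-link : ∀ {ξ y} → Odd (3 + ξ) → ∀ K → 1 ≤ K → ∃₂ λ l m → Link (3 + ξ) y K l m × l ≤ 3 + ξ + ξ × (2 + ξ ≤ l ⊎ l ≡ K)
find-link {ξ} {y} oˣ K 1≤K with divide (2 + ξ) K
find-link {ξ} {y} oˣ K () | zero , zero , r<x , refl
find-link {ξ} {y} oˣ K 1≤K | suc r , zero , r<x , refl = _ , _ , subst (λ K → Link (3 + ξ) y K K 0)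
    (sym (+-identityʳ (suc r))) (all-ones-link r) ,
  ≤-trans (≤-reflexive (+-identityʳ (suc r))) (≤-trans (<⇒≤ r<x) (m≤m+n (3 + ξ) ξ)) , inj₂ refl
find-link {ξ} {y} oˣ K 1≤K | zero , suc h , r<x , refl = _ , _ , link (relabelᵗ {0} t (eq ξ h))
    (hop₁ (distance 1 (trans (cong (_+ 1) (exit-odd oˣ)) (eq₂ ξ h)))) ,
    ≤-trans (≤-reflexive (+-comm (2 + ξ) 1)) (m≤m+n (3 + ξ) ξ) , inj₁ (m≤m+n (2 + ξ) 1)
  where
  t = only-Q (ascending 0 (2 + ξ)) h
  eq : ∀ ξ h → suc h * (3 + ξ) ≡ suc (2 + ξ + h * (3 + ξ))
  eq = solve-∀
  eq₂ : ∀ ξ h → h * (3 + ξ) + 0 + (2 + ξ) + 1 ≡ suc h * (3 + ξ)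
  eq₂ = solve-∀
find-link {ξ} {y} oˣ K 1≤K | suc r , suc h , s≤s r<x , refl = _ , _ , link
    (permute (↭-reflexive (cong (range 0) (+-suc r _))) (prepend r (relabelᵗ {0} t (eq ξ h))))
    (hopˣ (distance (3 + ξ) (trans (cong (λ e → r + e + (3 + ξ))
        (trans (sym (+-identityʳ _)) (exit-odd {3 + ξ} {1} {h} {0} {d = true} oˣ))) (eq₂ ξ h r)))) ,
    ≤-trans (≤-reflexive (trans (+-identityʳ _) (+-comm r (2 + ξ))))
        (≤-trans (+-monoʳ-≤ (2 + ξ) (≤-pred r<x)) (≤-reflexive (+-suc (2 + ξ) ξ))) ,
    inj₁ (≤-trans (m≤n+m (2 + ξ) r) (m≤m+n (r + (2 + ξ)) 0))
  where
  t = descending-columns₀ {0} refl h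
  eq : ∀ ξ h → suc (suc h * (3 + ξ)) ≡ suc (2 + ξ + suc (h * (3 + ξ)))
  eq = solve-∀
  eq₂ : ∀ ξ h r → r + (h * (3 + ξ) + 1 + 0) + (3 + ξ) ≡ suc r + suc h * (3 + ξ)
  eq₂ = solve-∀

SplitFor : ℕ → ℕ → ℕ → ℕ → Set
SplitFor ξ y s M = ∃₂ λ τ β → Split (3 + ξ) y M τ β × 2 + ξ ≤ τ × τ ≤ s

-- With M ≥ 2x every column has at least two vertices, so a path can end with an x-step. Below that,
-- for odd x, an odd M makes M - x even, as `ascending-columns` needs. The bound x + 2 excludes M =
-- x, which for x = 3 leaves no x-step at all.
Good : ℕ → ℕ → Set
Good x M = x + x ≤ M ⊎ Odd M × x + 2 ≤ M

split-long : ∀ {ξ y} → Odd (3 + ξ) → ∀ M → 3 + ξ + (3 + ξ) ≤ M → SplitFor ξ y (3 + ξ) M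
split-long {ξ} {y} oˣ M 2x≤M with divide (2 + ξ) M
... | r , 0 , r<x , refl = ⊥-elim (<⇒≱ (≤-trans r<x (m≤m+n _ _)) (≤-trans 2x≤M (≤-reflexive (+-identityʳ r))))
... | r , 1 , r<x , refl = ⊥-elim (<⇒≱ (+-monoˡ-< (3 + ξ) r<x) (≤-trans 2x≤M (≤-reflexive (cong (r +_) (*-identityˡ (3 + ξ))))))
... | r , 2+ h , r<x , refl with even⊎odd r
... | inj₁ even = _ , _ , proj₂ (split-of {0} (+-comm (2+ h * (3 + ξ)) r) (ascending-columns⁻ (proj₂ (gap r<x)) even h)) ,
  ≤-refl , n≤1+n _
split-long {ξ} {y} oˣ M 2x≤M | zero , 2+ h , r<x , refl | inj₂ odd = ⊥-elim (even-odd-absurd (0 , refl) odd)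
split-long {ξ} {y} oˣ M 2x≤M | suc r , 2+ h , r<x , refl | inj₂ odd = _ , _ ,
  prepend-split 1 (proj₂ (split-of {0} (+-comm (2+ h * (3 + ξ)) r)
      (ascending-columns⁻ (proj₂ (gap (<-trans (n<1+n r) r<x))) (odd-suc odd) h))) ,
  n≤1+n _ , ≤-refl

split-short : ∀ {ξ y} → Odd (3 + ξ) → ∀ M → Odd M → 3 + ξ ≤ M → M < 3 + ξ + (3 + ξ) → SplitFor ξ y (3 + ξ) M
split-short {ξ} {y} oˣ M odd x≤M M<2x with m≤n⇒∃[o]m+o≡n x≤M
... | r , refl with gap (+-cancelˡ-< (3 + ξ) r (3 + ξ) M<2x)
... | S , R+S with split-last (relabelᵗ {0} {3 + ξ} {y} {b = r} (ascending-columns R+S (odd∸odd oˣ odd) 0)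
    (cong (λ n → n + r) (+-identityʳ (3 + ξ))))
... | τ , β , t , x≤τ , τ≤x = τ , β , subst (λ n → Split (3 + ξ) y (n + r) τ β) (+-identityʳ (3 + ξ)) t , x≤τ , τ≤x

split-three : ∀ {y} M → Good 3 M → SplitFor 0 y 2 M
split-three M good with divide 2 M
... | 0 , 2+ h , r<3 , refl = _ , _ , proj₂ (split-of {0} (+-identityʳ (2+ h * 3)) (ascending-columns⁻ refl (0 , refl) h))
    , ≤-refl , ≤-refl
... | 1 , 2+ h , r<3 , refl = _ , _ , proj₂ (split-of {0} refl (descending-columns₀⁻ refl h)) , ≤-refl , ≤-refl
... | 2 , 2+ h , r<3 , refl = _ , _ , proj₂ (split-of {0} (+-comm (2+ h * 3) 2) (ascending-columns⁻ refl (1 , refl) h)) ,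
    ≤-refl , ≤-refl
-- Two of the three columns of 0, ..., 4 have two vertices and one has a single vertex; this
-- explicit order ends with a 3-step.
... | 2 , 1 , r<3 , refl = 2 , 3 , split {p = 0 ∷ 3 ∷ 2 ∷ 1 ∷ []} (stepˣ refl (step₁ refl (step₁ refl stop))) (hopˣ refl)
    perm , ≤-refl , ≤-refl
  where
  perm : 0 ∷ 3 ∷ 2 ∷ 1 ∷ 4 ∷ [] ↭ range 0 5
  perm = prep 0 (↭-trans (↭-sym (shift 3 (2 ∷ 1 ∷ []) (4 ∷ []))) (_↭_.swap 2 1 ↭-refl))
split-three M (inj₁ (s≤s (s≤s (s≤s ())))) | 0 , 1 , r<3 , refl
split-three M (inj₁ (s≤s (s≤s (s≤s (s≤s ()))))) | 1 , 1 , r<3 , refl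
split-three M (inj₁ ()) | 0 , 0 , r<3 , refl
split-three M (inj₁ (s≤s ())) | 1 , 0 , r<3 , refl
split-three M (inj₁ (s≤s (s≤s ()))) | 2 , 0 , r<3 , refl
split-three M (inj₂ (_ , s≤s (s≤s (s≤s ())))) | 0 , 1 , r<3 , refl
split-three M (inj₂ (_ , s≤s (s≤s (s≤s (s≤s ()))))) | 1 , 1 , r<3 , refl
split-three M (inj₂ (_ , ())) | 0 , 0 , r<3 , refl
split-three M (inj₂ (_ , s≤s ())) | 1 , 0 , r<3 , refl
split-three M (inj₂ (_ , s≤s (s≤s ()))) | 2 , 0 , r<3 , refl
split-three M good | 2+ (suc r) , h , s≤s (s≤s (s≤s ())) , refl

split-large : ∀ {ξ y} → Odd (3 + ξ) → ∀ M → Good (3 + ξ) M → SplitFor ξ y (3 + ξ) M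
split-large {ξ} oˣ M good with ≤-<-connex (3 + ξ + (3 + ξ)) M | good
... | inj₁ 2x≤M | _ = split-long oˣ M 2x≤M
... | inj₂ M<2x | inj₁ 2x≤M = split-long oˣ M 2x≤M
... | inj₂ M<2x | inj₂ (odd , x+2≤M) = split-short oˣ M odd (≤-trans (m≤m+n (3 + ξ) 2) x+2≤M) M<2x

-- Few ones when there are many x-steps

-- The realization joins one for {1^a′, x^b′} with a′ ≥ s to one with at most s + 2x - 3 ones, at most y - 2x + 2 x-steps
-- and all the y-steps.  Here s bounds the ones that a standard realization with steps 1 and x needs: s = x always suffices, s = 2 if x = 3.
module Few-ones {ξ y′ s : ℕ} (oˣ : Odd (3 + ξ)) (ξ<s : ξ < s) (s≤x : s ≤ 3 + ξ)
  (stdˣ : ∀ a b → s ≤ a → Standard (3 + ξ) (suc y′) a b 0)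
  (splitˣ : ∀ M → Good (3 + ξ) M → SplitFor ξ (suc y′) s M)
  (y-bound₁ : 3 + ξ + s ≤ y′) (y-bound₂ : s + s < y′) (y-bound₃ : 3 + ξ + suc ξ ≤ y′)
  (room : ∀ {K M l} → M + K ≡ suc y′ → Even K → 1 ≤ K → 2 + ξ ≤ l ⊎ l ≡ K → (K ≤ s × Even M) ⊎ (Odd M × 3 + ξ + 2 ≤ M) →
          ∃[ M₀ ] M ≡ (2 + ξ ∸ l) + M₀ × Good (3 + ξ) M₀)
  where

  x y ones : ℕ
  x = 3 + ξ
  y = suc y′
  ones = 3 + ξ + ξ

  -- A link with fewer than x - 1 ones is padded to x - 1, since with too few ones the path would
  -- need more x-steps than b provides. The padding stays within 2x - 3.
  bound-total : ∀ {l} → l ≤ ones → l + (2 + ξ ∸ l) ≤ ones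
  bound-total {l} l≤ with ≤-total l (2 + ξ)
  ... | inj₁ l≤x = ≤-trans (≤-reflexive (m+[n∸m]≡n l≤x)) (≤-trans (n≤1+n _) (m≤m+n (3 + ξ) ξ))
  ... | inj₂ x≤l = ≤-trans (≤-reflexive (trans (cong (l +_) (m≤n⇒m∸n≡0 x≤l)) (+-identityʳ l))) l≤

  fits : ∀ {K M l} → M + K ≡ y → s < M → 2 + ξ ≤ l ⊎ l ≡ K → s + (2 + ξ ∸ l) < M
  fits {K} {M} {l} M+K s<M (inj₁ x≤l) = subst (_< M) (sym (trans (cong (s +_) (m≤n⇒m∸n≡0 x≤l)) (+-identityʳ s))) s<M
  fits {K} {M} M+K s<M (inj₂ refl) with ≤-total (2 + ξ) K
  ... | inj₁ x≤K = fits {K} {M} M+K s<M (inj₁ x≤K)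
  ... | inj₂ K≤x = +-cancelʳ-< K _ M (subst₂ _<_ (sym (trans (+-assoc s _ K) (cong (s +_) (m∸n+n≡m K≤x)))) (sym M+K)
    (s≤s (≤-trans (≤-trans (≤-reflexive (+-comm s (2 + ξ))) (n≤1+n _)) y-bound₁)))

  indexed : ∀ {M} σ → s ≤ σ → σ < M → ∃₂ λ e β → Tour x y 0 e (range 0 M) σ β 0 × M ≡ suc (σ + β)
  indexed {M} σ s≤σ σ<M with gap σ<M
  ... | β , refl with stdˣ σ β s≤σ
  ... | n , e , t = e , β , permute (↭-reflexive (cong (range 0)
      (trans (size t) (trans (cong suc (+-identityʳ (σ + β))) (sym (+-suc σ β)))))) t , +-suc σ β

  module _ {a b c : ℕ} (a-bound : s + (s + ones) ≤ a) (b-bound : y ≤ b + suc ones) where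

    Goal = LinearRealization (a + b + c + 1) (mset a x b y c)

    conclude : ∀ {n e A B} → Trip x y 0 e (range 0 n) A B → n ≡ suc (A + B + c) → A ≤ s + ones → suc ones + B ≤ y → Goal
    conclude {A = A} {B} t eq A≤ B≤ = complete s (≤-trans (+-monoʳ-≤ s A≤) a-bound) (m∸n+n≡m B≤b)
        (λ a₁ le → stdˣ a₁ (b ∸ B) le) (_ , pinned t eq)
      where
      B≤b : B ≤ b
      B≤b = +-cancelʳ-≤ (suc ones) B b (≤-trans (≤-reflexive (+-comm B (suc ones))) (≤-trans B≤ b-bound))

    no-P : ∀ k → c ≡ k * y → Goal
    no-P k refl with indexed {y} ones (≤-trans s≤x (m≤m+n (3 + ξ) ξ)) (s≤s (≤-trans (+-monoʳ-≤ (3 + ξ) (n≤1+n ξ)) y-bound₃))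
    ... | e , β , t , y≡ = conclude (only-Q t k) (cong (_+ k * y) y≡) (m≤n+m ones s) (≤-reflexive (sym y≡))

    wrap : ∀ r k → c ≡ r + k * y → Odd r → r ≤ x → Goal
    wrap zero k _ odd _ = ⊥-elim (even-odd-absurd (0 , refl) odd)
    wrap (suc r) k refl odd r≤x with m≤n⇒∃[o]m+o≡n r≤x | gap {x} {y} (s≤s (≤-trans (m≤m+n x s) y-bound₁))
    ... | g , r+g | M , x+M with indexed {suc M} s ≤-refl (+-cancelˡ-< x s (suc M) (subst (x + s <_) (sym x+M) (s≤s y-bound₁)))
    ... | e , β , t , M≡ = conclude (proj₂ (wrap-around odd (odd∸odd odd (subst Odd (sym r+g) oˣ)) r+g x+M t k))
        (trans (eq₁ y (suc r) k) (cong (λ z → suc (z + (suc r + k * y))) (trans y≡ (eq₂ x s β))))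
        (≤-trans (≤-reflexive (+-comm x s)) (+-monoʳ-≤ s (m≤m+n x ξ)))
        (≤-trans (≤-reflexive (eq₃ x ξ β)) (≤-trans (+-monoʳ-≤ x (+-monoˡ-≤ (suc β) ξ<s))
            (≤-reflexive (sym (trans y≡ (eq₄ x s β))))))
      where
      y≡ : y ≡ x + suc (s + β)
      y≡ = trans (sym x+M) (cong (x +_) M≡)
      eq₁ : ∀ y r k → suc (suc k * y + r) ≡ suc (y + (r + k * y))
      eq₁ = solve-∀
      eq₂ : ∀ x s β → x + suc (s + β) ≡ x + s + suc β
      eq₂ = solve-∀
      eq₃ : ∀ x ξ β → suc (x + ξ) + suc β ≡ x + (suc ξ + suc β)
      eq₃ = solve-∀
      eq₄ : ∀ x s β → x + suc (s + β) ≡ x + (s + suc β)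
      eq₄ = solve-∀

    private
      eqʸ : ∀ l m σ β → suc (σ + β) + (l + m) ≡ suc (l + σ + (m + β))
      eqʸ = solve-∀

      total : ∀ {l m K M σ β} → l + m ≡ K → M ≡ suc (σ + β) → M + K ≡ y → y ≡ suc (l + σ + (m + β))
      total {l} {m} {σ = σ} {β} refl refl M+K = trans (sym M+K) (eqʸ l m σ β)

      A≤ : ∀ {l} → l ≤ ones → l + (s + (2 + ξ ∸ l)) ≤ s + ones
      A≤ {l} l≤ = ≤-trans (≤-reflexive (swap l s (2 + ξ ∸ l))) (+-monoʳ-≤ s (bound-total l≤))
        where
        swap : ∀ l s j → l + (s + j) ≡ s + (l + j)
        swap = solve-∀

      -- The padded link has at least x - 1 ones and s is at least x - 2. Together this is 2x - 3,
      -- so at most y - 2x + 2 of the y horizontal and block-changing steps are x-steps.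
      ones≤A : ∀ l → ones ≤ l + (s + (2 + ξ ∸ l))
      ones≤A l = ≤-trans (≤-reflexive (eq ξ)) (≤-trans (+-mono-≤ ξ<s (m≤n+m∸n (2 + ξ) l)) (≤-reflexive (swap l s (2 + ξ ∸ l))))
        where
        eq : ∀ ξ → 3 + ξ + ξ ≡ suc ξ + (2 + ξ)
        eq = solve-∀
        swap : ∀ l s j → s + (l + j) ≡ l + (s + j)
        swap = solve-∀

    P-first : ∀ r S k → c ≡ suc r + k * y → Even (suc r) → suc r + suc S ≡ y → s < suc S → Goal
    P-first r S k refl even r+S s<S with find-link {ξ} {y} oˣ (suc r) (s≤s z≤n)
    ... | l , m , L , l≤ , cond with indexed {suc S} (s + (2 + ξ ∸ l)) (m≤m+n s _)
        (fits {suc r} (trans (+-comm (suc S) (suc r)) r+S) s<S cond)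
    ... | e , β , t , S≡ = conclude (P-then-Q r+S even L t k) (trans (eq y (suc r) k) (cong (_+ (suc r + k * y)) y≡)) (A≤ l≤)
        (≤-trans (s≤s (+-monoˡ-≤ (m + β) (ones≤A l))) (≤-reflexive (sym y≡)))
      where
      y≡ = total {l} {m} {σ = s + (2 + ξ ∸ l)} {β} (link-total L) S≡ (trans (+-comm (suc S) (suc r)) r+S)
      eq : ∀ y r k → suc k * y + r ≡ y + (r + k * y)
      eq = solve-∀

    Q-first : ∀ R S k → c ≡ 2+ R + k * y → Even (suc S) → suc R + suc S ≡ y → s < suc R → Goal
    Q-first R S k refl even R+S s<R with find-link {ξ} {y} oˣ (suc S) (s≤s z≤n)
    ... | l , m , L , l≤ , cond with indexed {suc R} (s + (2 + ξ ∸ l)) (m≤m+n s _) (fits {suc S} R+S s<R cond)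
    ... | e , β , t , R≡ = conclude (Q-then-P R+S even L t k) (trans (eq y R k) (cong (_+ (2+ R + k * y)) y≡)) (A≤ l≤)
        (≤-trans (s≤s (+-monoˡ-≤ (m + β) (ones≤A l))) (≤-reflexive (sym y≡)))
      where
      y≡ = total {l} {m} {σ = s + (2 + ξ ∸ l)} {β} (link-total L) R≡ R+S
      eq : ∀ y R k → suc (suc k * y + suc R) ≡ y + (2+ R + k * y)
      eq = solve-∀

    -- The disjunction collects the situations in which P has enough columns for a split that
    -- remains possible after padding; `room` makes this precise.
    split-last-columns : ∀ R S k → c ≡ suc R + k * y → Even (suc S) → suc R + suc S ≡ y → (suc S ≤ s × Even (suc R)) ⊎
        (Odd (suc R) × x + 2 ≤ suc R) → Goal
    split-last-columns R S k refl even R+S big with find-link {ξ} {y} oˣ (suc S) (s≤s z≤n)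
    ... | l , m , L , l≤ , cond with room R+S even (s≤s z≤n) cond big
    ... | M₀ , R≡ , good with splitˣ M₀ good
    ... | τ , β , t , x≤τ , τ≤s = conclude (proj₂ (Q-then-split-P R+S even L
        (subst (λ n → Split x y n (2 + ξ ∸ l + τ) β) (sym R≡) (prepend-split (2 + ξ ∸ l) t)) k))
        (trans (eq₁ y R k) (cong (λ z → suc (z + (suc R + k * y))) y≡))
        (≤-trans (≤-reflexive (trans (sym (+-assoc l _ τ)) (+-comm (l + (2 + ξ ∸ l)) τ))) (+-mono-≤ τ≤s (bound-total l≤)))
        (≤-trans (+-monoˡ-≤ (m + β) (≤-trans (≤-reflexive (eq₂ ξ))
            (≤-trans (+-mono-≤ (m≤n+m∸n (2 + ξ) l) x≤τ) (≤-reflexive (+-assoc l _ τ))))) (≤-reflexive (sym y≡)))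
      where
      eq₀ : ∀ j τ β l m → j + (τ + β) + (l + m) ≡ l + (j + τ) + (m + β)
      eq₀ = solve-∀
      y≡ : y ≡ l + (2 + ξ ∸ l + τ) + (m + β)
      y≡ = trans (sym R+S) (trans (cong₂ _+_ (trans R≡ (cong (2 + ξ ∸ l +_) (sym (split-total t)))) (sym (link-total L)))
          (eq₀ (2 + ξ ∸ l) τ β l m))
      eq₁ : ∀ y R k → suc (suc k * y + suc R) ≡ suc (y + (suc R + k * y))
      eq₁ = solve-∀
      eq₂ : ∀ ξ → suc (3 + ξ + ξ) ≡ 2 + ξ + (2 + ξ)
      eq₂ = solve-∀

    -- For even r the block P goes first, unless Q is too short to hold s ones. Then Q goes first:
    -- with P split if S is even, and with one column of P shortened by removing vertex 0 if S is
    -- odd. The same two ways serve odd r > x, according to the parity of y; odd r ≤ x uses the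
    -- wrap.
    few-ones : Goal
    few-ones with divide y′ c
    ... | r , k , r<y , c≡ with even⊎odd r | gap r<y
    few-ones | zero , k , r<y , c≡ | inj₁ even | _ = no-P k c≡
    few-ones | suc r , k , r<y , c≡ | inj₁ even | S , r+S with ≤-<-connex (suc S) s
    ... | inj₂ s<S = P-first r S k c≡ even r+S s<S
    ... | inj₁ S≤s with even⊎odd (suc S)
    ... | inj₁ evenS = split-last-columns r S k c≡ evenS r+S (inj₁ (S≤s , even))
    few-ones | suc zero , k , r<y , c≡ | inj₁ even | S , r+S | inj₁ S≤s | inj₂ oddS = ⊥-elim (even-odd-absurd even (0 , refl))
    few-ones | 2+ r , k , r<y , c≡ | inj₁ even | S , r+S | inj₁ S≤s | inj₂ oddS =
      Q-first r (suc S) k c≡ (suc-odd oddS) R+K (+-cancelʳ-< (2+ S) s (suc r) (subst (s + 2+ S <_) (sym R+K)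
        (≤-trans (s≤s (≤-trans (+-monoʳ-≤ s (s≤s S≤s)) (≤-reflexive (+-suc s s)))) (s≤s y-bound₂))))
      where
      R+K : suc r + 2+ S ≡ y
      R+K = trans (cong suc (+-suc r (suc S))) r+S
    few-ones | r , k , r<y , c≡ | inj₂ odd | S , r+S with ≤-<-connex r x
    ... | inj₁ r≤x = wrap r k c≡ odd r≤x
    few-ones | suc r , k , r<y , c≡ | inj₂ odd | S , r+S | inj₂ (s≤s x≤r) with even⊎odd y | m≤n⇒m<n∨m≡n x≤r
    ... | _ | inj₂ refl = ⊥-elim (even-odd-absurd (odd-suc odd) oˣ)
    ... | inj₂ oddʸ | inj₁ x<r = split-last-columns r S k c≡ (odd∸odd odd (subst Odd (sym r+S) oddʸ)) r+S
        (inj₂ (odd , subst (_≤ suc r) (+-comm 2 x) (s≤s x<r)))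
    few-ones | 2+ r , k , r<y , c≡ | inj₂ odd | S , r+S | inj₂ (s≤s x≤r) | inj₁ evenʸ | inj₁ x<r =
      Q-first r (suc S) k c≡ (even∸even (odd-suc odd) (subst Even (sym R+K) evenʸ)) R+K (≤-<-trans s≤x x<r)
      where
      R+K : suc r + 2+ S ≡ y
      R+K = trans (cong suc (+-suc r (suc S))) r+S

case₅ : ∀ {y} a b c → 3 < y → 7 ≤ a → y ≤ b + 4 → LinearRealization (a + b + c + 1) (mset a 3 b y c)
case₅ {suc y′} a b c 3<y 7≤a y≤ with ≤-<-connex y′ 5
-- For y ≤ 6 seven ones already reach x + y - 2.
... | inj₁ y≤6 = case₂-three a b c 3<y (≤-trans (+-monoʳ-≤ 2 y≤6) 7≤a)
... | inj₂ 6<y = few-ones 7≤a y≤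
  where
  room : ∀ {K M l} → M + K ≡ suc y′ → Even K → 1 ≤ K → 2 ≤ l ⊎ l ≡ K → (K ≤ 2 × Even M) ⊎ (Odd M × 5 ≤ M) → ∃[ M₀ ] M ≡
      (2 ∸ l) + M₀ × Good 3 M₀
  room {suc zero} _ even _ _ _ = ⊥-elim (even-odd-absurd even (0 , refl))
  room {2+ K} {M} {l} M+K even _ cond big = M , sym (cong (_+ M) (m≤n⇒m∸n≡0 (two cond))) , good big
    where
    two : 2 ≤ l ⊎ l ≡ 2+ K → 2 ≤ l
    two (inj₁ 2≤l)  = 2≤l
    two (inj₂ refl) = s≤s (s≤s z≤n)
    good : (2+ K ≤ 2 × Even M) ⊎ (Odd M × 5 ≤ M) → Good 3 M
    good (inj₂ odd) = inj₂ odd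
    good (inj₁ (K≤2 , evenM)) with m≤n⇒m<n∨m≡n 5≤M
      where
      5≤M : 5 ≤ M
      5≤M = +-cancelʳ-≤ 2 5 M (≤-trans (s≤s 6<y) (≤-trans (≤-reflexive (sym M+K)) (+-monoʳ-≤ M K≤2)))
    ... | inj₁ 6≤M  = inj₁ 6≤M
    ... | inj₂ refl = ⊥-elim (even-odd-absurd evenM (2 , refl))
  open Few-ones {0} {y′} {2} (1 , refl) (s≤s z≤n) (s≤s (s≤s z≤n)) (λ a b 2≤a → of-x {0} (mono₃ a b 2≤a)) split-three
    (≤-trans (n≤1+n 5) 6<y) (≤-trans (n≤1+n 5) 6<y) (≤-trans (s≤s (s≤s (s≤s (s≤s z≤n)))) 6<y) room

case₃ : ∀ {ξ y} a b c → Odd (3 + ξ) → 3 + ξ < y → 3 + ξ + (3 + ξ + (3 + ξ + ξ)) ≤ a → y ≤ b + suc (3 + ξ + ξ) →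
        LinearRealization (a + b + c + 1) (mset a (3 + ξ) b y c)
case₃ {ξ} {suc y′} a b c oˣ x<y a-bound b-bound with ≤-<-connex (suc y′) (3 + ξ + (3 + ξ) + suc ξ)
-- For y ≤ 3x - 2 the bound x + y - 1 is at most 4x - 3.
... | inj₁ y≤ = case₁ (s≤s (s≤s z≤n)) x<y a b c (≤-trans (+-monoʳ-≤ (2 + ξ) y≤) (≤-trans (≤-reflexive (eq ξ)) a-bound))
  where
  eq : ∀ ξ → 2 + ξ + (3 + ξ + (3 + ξ) + suc ξ) ≡ 3 + ξ + (3 + ξ + (3 + ξ + ξ))
  eq = solve-∀
... | inj₂ (s≤s y>) = few-ones a-bound b-bound
  where
  x = 3 + ξ
  room : ∀ {K M l} → M + K ≡ suc y′ → Even K → 1 ≤ K → 2 + ξ ≤ l ⊎ l ≡ K → (K ≤ x × Even M) ⊎ (Odd M × x + 2 ≤ M) → ∃[ M₀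
      ] M ≡ (2 + ξ ∸ l) + M₀ × Good x M₀
  room {K} {M} {l} M+K even _ cond big with ≤-<-connex (2 + ξ) l | cond
  ... | inj₁ x≤l | _ = M , sym (cong (_+ M) (m≤n⇒m∸n≡0 x≤l)) , good big
    where
    good : (K ≤ x × Even M) ⊎ (Odd M × x + 2 ≤ M) → Good x M
    good (inj₂ odd) = inj₂ odd
    good (inj₁ (K≤x , _)) with m≤n⇒m<n∨m≡n K≤x
    ... | inj₂ refl = ⊥-elim (even-odd-absurd even oˣ)
    ... | inj₁ (s≤s K<x) = inj₁ (+-cancelʳ-≤ (2 + ξ) (x + x) M
      (≤-trans (≤-reflexive (+-suc (x + x) (suc ξ))) (≤-trans (s≤s y>) (≤-trans (≤-reflexive (sym M+K)) (+-monoʳ-≤ M K<x)))))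
  ... | inj₂ l<x | inj₁ x≤l = ⊥-elim (<⇒≱ l<x x≤l)
  -- Link and padding together occupy x - 1 columns. Of the y ≥ 3x - 1 columns at least 2x remain
  -- for the split.
  ... | inj₂ K<x | inj₂ refl with m≤n⇒∃[o]m+o≡n y>
  ... | o , y≡ = x + x + o , +-cancelʳ-≡ K M (2 + ξ ∸ K + (x + x + o)) (trans M+K (trans (cong suc (sym y≡)) (trans (eq ξ o)
      (trans (cong (_+ (x + x + o)) (sym (m∸n+n≡m (<⇒≤ K<x)))) (eq′ (2 + ξ ∸ K) (x + x + o) K))))) , inj₁ (m≤m+n (x + x) o)
    where
    eq : ∀ ξ o → suc (3 + ξ + (3 + ξ) + suc ξ + o) ≡ 2 + ξ + (3 + ξ + (3 + ξ) + o)
    eq = solve-∀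
    eq′ : ∀ j M₀ K → j + K + M₀ ≡ j + M₀ + K
    eq′ = solve-∀
  open Few-ones {ξ} {y′} {x} oˣ (s≤s (≤-trans (n≤1+n ξ) (n≤1+n _))) ≤-refl (λ a b x≤a → of-x {0} (mono a b x≤a)) (split-large oˣ)
    (≤-trans (m≤m+n (x + x) (suc ξ)) y>) (≤-trans (s≤s (m≤m+n (x + x) ξ)) (≤-trans (≤-reflexive (sym (+-suc (x + x) ξ))) y>))
    (≤-trans (+-monoˡ-≤ (suc ξ) (m≤m+n x x)) y>) room

-- Residue classes mod x when x divides y

-- Index i stands for the vertex β + xi of a class, so 1-steps become x-steps and t-steps become
-- y-steps. The number of x-steps stays open, as the length determines it.
Line : ℕ → ℕ → ℕ → Set
Line t n γ = ∃₂ λ e α → Tour 0 t 0 e (range 0 n) α 0 γ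

line-from : ∀ {t n α γ} → suc (α + γ) ≡ n → Mono 0 t α γ → Line t n γ
line-from {α = α} refl (e , τ) = e , α , τ

scale : ∀ {x t s e p a c} β → Walk 0 t s e p a 0 c → Walk x (t * x) (β + x * s) (β + x * e) (map (λ j → β + x * j) p) 0 a c
scale β stop = stop
scale {x} {t} β (step₁ {u} {w} d v) = stepˣ (trans (∣m+n-m+o∣≡∣n-o∣ β (x * u) (x * w))
  (trans (sym (*-distribˡ-∣-∣ x u w)) (trans (cong (x *_) d) (*-identityʳ x)))) (scale β v)
scale {x} {t} β (stepʸ {u} {w} d v) = stepʸ (trans (∣m+n-m+o∣≡∣n-o∣ β (x * u) (x * w))
  (trans (sym (*-distribˡ-∣-∣ x u w)) (trans (cong (x *_) d) (*-comm x t)))) (scale β v)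

place : ∀ {x t n e α γ} β → Tour 0 t 0 e (range 0 n) α 0 γ → Tour x (t * x) β (β + x * e) (progression β x n) 0 α γ
place {x} {n = n} β (p , w , p↭) = endsᵀ base refl (_ , scale β w ,
    ↭-trans (map⁺ _ p↭) (↭-reflexive (trans (map-*-range β x 0 n) (cong (λ s → progression s x n) base))))
  where
  base : β + x * 0 ≡ β
  base = trans (cong (β +_) (*-zeroʳ x)) (+-identityʳ β)

-- An odd number t of columns, all full, is left at the far end of the last one: the walk leads from
-- one end of the line to the other.
perfect-line : ∀ {t′} → Odd (suc t′) → ∀ j m → Tour 0 (suc t′) 0 (j + (m * suc t′ + t′)) (range 0 (j + suc m * suc t′))
    (j + t′) 0 (m * suc t′)
perfect-line {t′} odd j m = prepend j (endsᵀ refl (trans (exit-odd odd) (cong (_+ t′) (+-identityʳ (m * suc t′))))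
  (pin (only-Q (ascending 0 t′) m) (length-range 0 _) (eq t′ m)))
  where
  eq : ∀ t m → suc m * suc t ≡ suc (t + 0 + m * suc t)
  eq = solve-∀

lines : ℕ → (ℕ → ℕ) → ℕ → List ℕ → List ℕ
lines x f n = concatMap (λ j → progression (f j) x n)

-- Distributing the y-steps over the residue classes

module Lines (x t s : ℕ) (line : ∀ α γ → s ≤ α → Mono 0 t α γ) where

  y : ℕ
  y = t * x

  line-of : ∀ {n γ} → γ + suc s ≤ n → Line t n γ
  line-of {n} {γ} le with m≤n⇒∃[o]m+o≡n le
  ... | o , refl = line-from (eq s o γ) (line (s + o) γ (m≤m+n s o))
    where
    eq : ∀ s o γ → suc (s + o + γ) ≡ γ + suc s + o
    eq = solve-∀

  pair : ∀ {n γ β β′} → Line t n γ → ∣ β - β′ ∣ ≡ 1 → ∃[ b ] Tour x y β β′ (progression β x n ++ progression β′ x n) 1 b (γ + γ)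
  pair {β = β} {β′} (e , α , τ) d = _ , place β τ ◂ hop₁ (trans
      (trans (cong₂ ∣_-_∣ (+-comm β _) (+-comm β′ _)) (∣m+n-m+o∣≡∣n-o∣ (x * e) β β′)) d) ▸ reverseᵀ (place β′ τ)

  -- A prefix of a tour in continuation form, so that it may be empty, which a tour cannot be.
  record Lead (u w : ℕ) (W : List ℕ) (k c : ℕ) : Set where
    constructor lead
    field
      extend : ∀ {e V a b c′} → Tour x y w e V a b c′ → ∃[ b′ ] Tour x y u e (W ++ V) (k + a) b′ (c + c′)
  open Lead public

  module _ {q n : ℕ} (f : ℕ → ℕ) (cap : q + suc s ≤ n) where

    -- m pairs of lines, each traversed away from the base and back; the y-steps are used up greedily.
    pairs : ∀ m i C → (∀ j → j < i + m * 2 → ∣ f j - f (suc j) ∣ ≡ 1) →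
            ∃₂ λ c r → c + r ≡ C × (r ≤ 1 ⊎ c ≡ m * (q + q)) × Lead (f i) (f (i + m * 2)) (lines x f n (range i (m * 2))) (m * 2) c
    pairs zero i C adj = 0 , C , refl , inj₂ refl , lead (λ T → _ , endsᵀ (cong f (+-identityʳ i)) refl T)
    pairs (suc m) i C adj = choose (≤-<-connex (q + q) C)
      where
      i+2m : i + suc m * 2 ≡ 2+ i + m * 2
      i+2m = trans (+-suc i (suc (m * 2))) (cong suc (+-suc i (m * 2)))

      adj′ : ∀ j → j < 2+ i + m * 2 → ∣ f j - f (suc j) ∣ ≡ 1
      adj′ j j< = adj j (subst (j <_) (sym i+2m) j<)

      attach : ∀ {γ c} → γ ≤ q → Lead (f (2+ i)) (f (2+ i + m * 2)) (lines x f n (range (2+ i) (m * 2))) (m * 2) c →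
               Lead (f i) (f (i + suc m * 2)) (lines x f n (range i (suc m * 2))) (suc m * 2) (γ + γ + c)
      attach {γ} {c} γ≤q rest = lead continue
        where
        continue : ∀ {e V a b c′} → Tour x y (f (i + suc m * 2)) e V a b c′ → ∃[ b′ ] Tour x y (f i) e
            (lines x f n (range i (suc m * 2)) ++ V) (suc m * 2 + a) b′ (γ + γ + c + c′)
        continue {V = V} {c′ = c′} T with extend rest (endsᵀ (cong f i+2m) refl T) | pair
            (line-of {n} {γ} (≤-trans (+-monoˡ-≤ (suc s) γ≤q) cap)) (adj′ i (≤-trans (n≤1+n _) (m≤m+n (2+ i) (m * 2))))
        ... | b′ , T′ | b″ , T″ = _ , permute (↭-reflexive (perm (progression (f i) x n) _ _ V))
            (recountᵀ refl refl (sym (+-assoc (γ + γ) c c′))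
              (T″ ◂ hop₁ (adj′ (suc i) (m≤m+n (2+ i) (m * 2))) ▸ T′))
          where
          perm : ∀ (A B D V : List ℕ) → (A ++ B) ++ (D ++ V) ≡ (A ++ (B ++ D)) ++ V
          perm A B D V = trans (sym (++-assoc (A ++ B) D V)) (cong (_++ V) (++-assoc A B D))

      choose : q + q ≤ C ⊎ C < q + q → ∃₂ λ c r → c + r ≡ C × (r ≤ 1 ⊎ c ≡ suc m * (q + q)) × Lead (f i)
          (f (i + suc m * 2)) (lines x f n (range i (suc m * 2))) (suc m * 2) c
      choose (inj₁ 2q≤C) with m≤n⇒∃[o]m+o≡n 2q≤C
      ... | C′ , refl with pairs m (2+ i) C′ adj′
      ... | c , r , refl , inj₁ r≤1 , rest = q + q + c , r , +-assoc (q + q) c r , inj₁ r≤1 , attach ≤-refl rest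
      ... | c , r , refl , inj₂ full , rest = q + q + c , r , +-assoc (q + q) c r , inj₂ (cong (q + q +_) full) , attach ≤-refl rest
      -- A pair carries an even number of y-steps, so from here on at most one is left over.
      choose (inj₂ C<2q) with halve C
        where
        halve : ∀ C → ∃₂ λ γ r → γ + γ + r ≡ C × r ≤ 1
        halve C with even⊎odd C
        ... | inj₁ (k , refl) = k , 0 , +-identityʳ (k + k) , z≤n
        ... | inj₂ (k , refl) = k , 1 , +-comm (k + k) 1 , ≤-refl
      ... | γ , C′ , refl , C′≤1 with pairs m (2+ i) C′ adj′
      ... | c , r , refl , _ , rest = γ + γ + c , r , +-assoc (γ + γ) c r , inj₁ (≤-trans (m≤n+m r c) C′≤1) ,
        attach (half (≤-trans (m≤m+n (γ + γ) (c + r)) (<⇒≤ C<2q))) rest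
        where
        half : γ + γ ≤ q + q → γ ≤ q
        half le with ≤-<-connex γ q
        ... | inj₁ γ≤q = γ≤q
        ... | inj₂ q<γ = ⊥-elim (<⇒≱ (+-mono-< q<γ q<γ) le)

strips : ℕ → ℕ → List ℕ → List ℕ
strips x n = concatMap (λ β → progression β x n)

strips-↭ : ∀ {x n B B′} → B ↭ B′ → strips x (suc n) B ↭ strips x (suc n) B′
strips-↭ {x} {n} = columns-↭ {x} {x} {0} {n}

lines≡strips : ∀ x f n p → lines x f n p ≡ strips x n (map f p)
lines≡strips x f n p = sym (concatMap-map (λ β → progression β x n) f p)

strips≡columns : ∀ x β h n → strips x (suc h) (range β n) ≡ columns x β h (range 0 n)
strips≡columns x β h n = trans (cong (strips x (suc h)) (sym (trans (map-+-progression β 0 1 n)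
    (cong (λ s → range s n) (+-identityʳ β)))))
  (sym (lines≡strips x (β +_) (suc h) (range 0 n)))

-- Either some pair was not filled, and at most one y-step is left, or all pairs are full and the
-- total capacity leaves at most q.
remaining : ∀ {c₁ r₁ c₂ r₂ F₁ F₂ C q} → c₁ + r₁ ≡ C → r₁ ≤ 1 ⊎ c₁ ≡ F₁ → c₂ + r₂ ≡ r₁ → r₂ ≤ 1 ⊎ c₂ ≡ F₂ → C ≤ F₁ +
    (F₂ + q) → r₂ ≤ 1 ⊎ r₂ ≤ q
remaining {c₂ = c₂} {r₂} refl (inj₁ r₁≤1) refl _ _ = inj₁ (≤-trans (m≤n+m r₂ c₂) r₁≤1)
remaining refl (inj₂ _) refl (inj₁ r₂≤1) _ = inj₁ r₂≤1
remaining {c₁} {c₂ = c₂} {r₂} {q = q} refl (inj₂ refl) refl (inj₂ refl) le = inj₂ (+-cancelˡ-≤ c₂ r₂ q (+-cancelˡ-≤ c₁ _ _ le))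

three-lists : ∀ {A₁ A₂ A₃ B : List ℕ} {v} → A₂ ↭ v ∷ B → A₃ ++ v ∷ (A₁ ++ B) ↭ A₁ ++ (A₂ ++ (A₃ ++ []))
three-lists {A₁} {A₂} {A₃} {B} {v} A₂↭ = begin
    A₃ ++ v ∷ (A₁ ++ B)          ↭⟨ ++-comm A₃ (v ∷ (A₁ ++ B)) ⟩
    (v ∷ A₁ ++ B) ++ A₃          ↭⟨ ++⁺ʳ A₃ (↭-sym (shift v A₁ B)) ⟩
    (A₁ ++ v ∷ B) ++ A₃          ↭⟨ ++⁺ʳ A₃ (++⁺ˡ A₁ (↭-sym A₂↭)) ⟩
    (A₁ ++ A₂) ++ A₃             ≡⟨ trans (++-assoc A₁ A₂ A₃) (cong (λ A → A₁ ++ (A₂ ++ A)) (sym (++-identityʳ A₃))) ⟩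
    A₁ ++ (A₂ ++ (A₃ ++ []))     ∎
  where open PermutationReasoning

module Line-cases (x t′ s q h : ℕ) (line : ∀ α γ → s ≤ α → Mono 0 (suc t′) α γ) (k≡ : suc h ≡ suc s + q)
    (t<k : suc t′ ≤ h) (1≤t′ : 1 ≤ t′) where

  open Lines x (suc t′) s line

  t : ℕ
  t = suc t′

  abstract
    -- A single left-over y-step is treated apart because q may be 0; t < 1 + h leaves enough
    -- vertices for it.
    last-line : ∀ {γ} → γ ≤ 1 ⊎ γ ≤ q → Line t (suc h) γ
    last-line (inj₂ γ≤q) = line-of (≤-trans (+-monoˡ-≤ (suc s) γ≤q) (≤-reflexive (trans (+-comm q (suc s)) (sym k≡))))
    last-line (inj₁ γ≤1) with m≤n⇒∃[o]m+o≡n t<k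
    last-line (inj₁ z≤n) | o , t+o = line-from (trans (eq t′ o) (cong suc t+o))
        (mono-short (suc t′ + o) 0 0 (≤-trans (n≤1+n t′) (m≤m+n (suc t′) o)) (s≤s z≤n) (inj₁ (0 , refl)))
      where
      eq : ∀ t′ o → suc (suc t′ + o + 0) ≡ suc (suc t′ + o)
      eq = solve-∀
    last-line (inj₁ (s≤s z≤n)) | o , t+o = line-from (trans (eq t′ o) (cong suc t+o))
        (mono-short (t′ + o) 1 0 (m≤m+n t′ o) (s≤s 1≤t′) (inj₂ (inj₁ refl)))
      where
      eq : ∀ t′ o → suc (t′ + o + 1) ≡ suc (suc t′ + o)
      eq = solve-∀

  q-cap : q + suc s ≤ suc h
  q-cap = ≤-reflexive (trans (+-comm q (suc s)) (sym k≡))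

  sq-cap : suc q + suc s ≤ 2+ h
  sq-cap = s≤s q-cap

  -- The long classes pair up, and so do the short ones except the last.
  even-lines : ∀ {m₁ m₂ C} → m₁ * 2 + suc (m₂ * 2) ≡ x → C ≤ m₁ * (suc q + suc q) + (m₂ * (q + q) + q) →
               ∃₂ λ e b → Tour x y 0 e (range 0 (suc h * x + m₁ * 2)) (m₁ * 2 + (m₂ * 2 + 0)) b C
  even-lines {m₁} {m₂} {C} refl bound with pairs {suc q} (0 +_) sq-cap m₁ 0 C (λ j _ → distance 1 (+-comm j 1))
  ... | c₁ , r₁ , refl , cond₁ , lead₁ with pairs {q} (m₁ * 2 +_) q-cap m₂ 0 r₁
      (λ j _ → distance 1 (trans (+-assoc (m₁ * 2) j 1) (cong (m₁ * 2 +_) (+-comm j 1))))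
  ... | c₂ , r₂ , refl , cond₂ , lead₂ with last-line (remaining {c₁} {c₂ = c₂} refl cond₁ refl cond₂ bound)
  ... | e , α , τ with extend lead₂ (place (m₁ * 2 + m₂ * 2) τ)
  ... | b₂ , T₂ with extend lead₁ (endsᵀ (+-identityʳ (m₁ * 2)) refl T₂)
  ... | b₁ , T₁ = _ , b₁ , permute perm T₁
    where
    R = m₁ * 2
    S = m₂ * 2
    perm : columns x 0 (suc h) (range 0 R) ++ (columns x R h (range 0 S) ++ progression (R + S) x (suc h)) ↭ range 0 (suc h * x + R)
    perm = ↭-trans (++⁺ˡ (columns x 0 (suc h) (range 0 R)) (↭-reflexive
        (trans (cong (columns x R h (range 0 S) ++_) (sym (++-identityʳ _)))
        (trans (columns-++ x R h (range 0 S) [ S ]) (cong (columns x R h)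
            (trans (sym (range-++ 0 S 1)) (cong (range 0) (+-comm S 1)))))))) (cover R (suc S) 0 h)

  adjacent : ∀ {i} k → i + k ≤ x → ∀ j → j < i + k → ∣ x ∸ j - x ∸ suc j ∣ ≡ 1
  adjacent k le j j< = trans (∣m∸u-m∸w∣≡∣u-w∣ (≤-trans (<⇒≤ j<) le) (≤-trans j< le)) (distance 1 (+-comm j 1))

  -- An initial x-step from 0 leaves x classes of equal length, visited from base x downwards.
  equal-lines : ∀ {m C} → suc (m * 2) ≡ x → C ≤ m * (q + q) + q → ∃₂ λ e b → Tour x y 0 e (range 0 (suc (suc h * x)))
      (m * 2 + 0) b C
  equal-lines {m} {C} refl bound with pairs {q} (x ∸_) q-cap m 0 C (adjacent {0} (m * 2) (n≤1+n (m * 2)))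
  ... | c , r , refl , cond , lead′ with last-line (remaining {0} {c₂ = c} {F₁ = 0} refl (inj₂ refl) refl cond bound)
  ... | e , α , τ with extend lead′ (place (x ∸ m * 2) τ)
  ... | b , T = _ , _ , permute (prep 0 perm) (singleton 0 ◂ hopˣ refl ▸ T)
    where
    perm : lines x (x ∸_) (suc h) (range 0 (m * 2)) ++ progression (x ∸ m * 2) x (suc h) ↭ range 1 (suc h * x)
    perm = ↭-trans (↭-reflexive (trans (cong (lines x (x ∸_) (suc h) (range 0 (m * 2)) ++_) (sym (++-identityʳ _)))
        (trans (sym (concatMap-++ (λ j → progression (x ∸ j) x (suc h)) (range 0 (m * 2)) [ m * 2 ]))
          (trans (cong (lines x (x ∸_) (suc h)) (trans (sym (range-++ 0 (m * 2) 1)) (cong (range 0) (+-comm (m * 2) 1))))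
              (lines≡strips x (x ∸_) (suc h) (range 0 x))))))
      (↭-trans (strips-↭ (range-reflect 1 x 0 x refl)) (↭-trans (↭-reflexive (strips≡columns x 1 h x))
          (↭-trans (cover 0 x 1 h) (↭-reflexive (cong (range 1) (+-identityʳ (suc h * x)))))))

  -- Three long lines at the end: the first is traversed to its far end, then the far end of the second, the third back to
  -- the base, and the rest of the second.
  abstract
    three-lines : ∀ {j m g} → Odd t → 2+ h ≡ j + suc m * t → Line t (suc h) g →
                  ∃₂ λ e b → Tour x y 3 e (strips x (2+ h) (range 1 3)) 3 b (m * t + (m * t + g))
    three-lines {j} {m} {g} odd len (e , α , τ) = _ , _ , permute
        (three-lists {progression 1 x (2+ h)} {A₃ = progression 3 x (2+ h)} (far 2))
        (place 3 T ◂ hop₁ (step (suc zero)) ▸ singleton (2 + x * suc h) ◂ hop₁ (step 0) ▸ reverseᵀ (place 1 T) ◂ hop₁ refl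
            ▸ place 2 τ)
      where
      step : ∀ i → ∣ 2+ i + x * suc h - suc i + x * suc h ∣ ≡ 1
      step i = distance˘ {2+ i + x * suc h} {suc i + x * suc h} 1 (+-comm (suc i + x * suc h) 1)
      eq : ∀ j m t′ → suc (j + (m * suc t′ + t′)) ≡ j + suc m * suc t′
      eq = solve-∀
      T : Tour 0 t 0 (suc h) (range 0 (2+ h)) (j + t′) 0 (m * t)
      T = subst (λ n → Tour 0 t 0 (suc h) (range 0 n) (j + t′) 0 (m * t)) (sym len)
        (endsᵀ refl (suc-injective (trans (eq j m t′) (sym len))) (perfect-line odd j m))
      far : ∀ β → progression β x (2+ h) ↭ (β + x * suc h) ∷ progression β x (suc h)
      far β = ↭-trans (progression-last β x (suc h)) (↭-reflexive
          (cong (_∷ progression β x (suc h)) (trans (+-comm (suc h * x) β) (cong (β +_) (*-comm (suc h) x)))))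

  -- After the initial x-step the short classes come first, in pairs. The long ones pair up except
  -- for the last three, two of which carry perfect lines.
  odd-lines : ∀ {m₁ m₂ j m C} → Odd t → 2+ h ≡ j + suc m * t → 3 + m₁ * 2 + m₂ * 2 ≡ x → C ≤ m₂ * (q + q) +
      (m₁ * (suc q + suc q) + q) →
              ∃₂ λ e b → Tour x y 0 e (range 0 (suc (suc h * x + (3 + m₁ * 2)))) (m₂ * 2 + (m₁ * 2 + 3)) b (m * t + (m * t + C))
  odd-lines {m₁} {m₂} {j} {m} {C} odd len refl bound with pairs {q} (x ∸_) q-cap m₂ 0 C
      (adjacent {0} (m₂ * 2) (m≤n+m (m₂ * 2) (3 + m₁ * 2)))
  ... | c₁ , r₁ , refl , cond₁ , lead₁ with pairs {suc q} (x ∸_) sq-cap m₁ (m₂ * 2) r₁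
      (adjacent {m₂ * 2} (m₁ * 2) (≤-trans (≤-reflexive (+-comm (m₂ * 2) (m₁ * 2))) (m≤n+m (m₁ * 2 + m₂ * 2) 3)))
  ... | c₂ , r₂ , refl , cond₂ , lead₂ with three-lines {j} {m} odd len
      (last-line (remaining {c₁} {c₂ = c₂} refl cond₁ refl cond₂ bound))
  ... | e , b , T with extend lead₂ (endsᵀ (sym x∸) refl T)
    where
    x∸ : x ∸ (m₂ * 2 + m₁ * 2) ≡ 3
    x∸ = trans (cong (x ∸_) (+-comm (m₂ * 2) (m₁ * 2))) (m+n∸n≡m 3 (m₁ * 2 + m₂ * 2))
  ... | b₂ , T₂ with extend lead₁ T₂
  ... | b₁ , T₁ = _ , _ , permute (prep 0 perm) (recountᵀ refl refl (eqᶜ c₁ c₂ r₂ (m * t)) (singleton 0 ◂ hopˣ refl ▸ T₁))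
    where
    open PermutationReasoning
    R = 3 + m₁ * 2
    S = m₂ * 2
    eqᶜ : ∀ c₁ c₂ r₂ g → c₁ + (c₂ + (g + (g + r₂))) ≡ g + (g + (c₁ + (c₂ + r₂)))
    eqᶜ = solve-∀
    eq₁ : ∀ m₁ m₂ → 4 + m₁ * 2 + (0 + m₂ * 2) ≡ suc (3 + m₁ * 2 + m₂ * 2)
    eq₁ = solve-∀
    eq₂ : ∀ m₁ m₂ → 4 + (m₂ * 2 + m₁ * 2) ≡ suc (3 + m₁ * 2 + m₂ * 2)
    eq₂ = solve-∀
    perm : lines x (x ∸_) (suc h) (range 0 S) ++ (lines x (x ∸_) (2+ h) (range S (m₁ * 2)) ++ strips x (2+ h) (range 1 3))
        ↭ range 1 (suc h * x + R)
    perm = begin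
      lines x (x ∸_) (suc h) (range 0 S) ++ (lines x (x ∸_) (2+ h) (range S (m₁ * 2)) ++ strips x (2+ h) (range 1 3))
        ≡⟨ cong₂ (λ A B → A ++ (B ++ strips x (2+ h) (range 1 3))) (lines≡strips x (x ∸_) (suc h) (range 0 S))
            (lines≡strips x (x ∸_) (2+ h) (range S (m₁ * 2))) ⟩
      strips x (suc h) (map (x ∸_) (range 0 S)) ++ (strips x (2+ h) (map (x ∸_) (range S (m₁ * 2))) ++ strips x (2+ h) (range 1 3))
        ↭⟨ ++⁺ (strips-↭ (range-reflect (suc R) x 0 S (eq₁ m₁ m₂))) (++⁺ʳ _ (strips-↭ (range-reflect 4 x S (m₁ * 2) (eq₂ m₁ m₂)))) ⟩
      strips x (suc h) (range (suc R) S) ++ (strips x (2+ h) (range 4 (m₁ * 2)) ++ strips x (2+ h) (range 1 3))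
        ↭⟨ ++⁺ˡ (strips x (suc h) (range (suc R) S)) (++-comm (strips x (2+ h) (range 4 (m₁ * 2))) (strips x (2+ h) (range 1 3))) ⟩
      strips x (suc h) (range (suc R) S) ++ (strips x (2+ h) (range 1 3) ++ strips x (2+ h) (range 4 (m₁ * 2)))
        ≡⟨ cong₂ _++_ (strips≡columns x (suc R) h S) (trans (sym
            (concatMap-++ (λ β → progression β x (2+ h)) (range 1 3) (range 4 (m₁ * 2)))) (strips≡columns x 1 (suc h) R)) ⟩
      columns x (suc R) h (range 0 S) ++ columns x 1 (suc h) (range 0 R)
        ↭⟨ ++-comm (columns x (suc R) h (range 0 S)) (columns x 1 (suc h) (range 0 R)) ⟩
      columns x 1 (suc h) (range 0 R) ++ columns x (suc R) h (range 0 S)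
        ↭⟨ cover R S 1 h ⟩
      range 1 (suc h * x + R) ∎

finish-lines : ∀ {x y e n a₀ b′ c} a b → Tour x y 0 e (range 0 n) a₀ b′ c → a₀ ≤ a → n ≡ suc (a₀ + b + c) →
    LinearRealization (a + b + c + 1) (mset a x b y c)
finish-lines {a₀ = a₀} {b′} {c} a b T a₀≤a n≡ = realize (recountᵀ (m∸n+n≡m a₀≤a) b≡ refl (prepend (a ∸ a₀) T))
  where
  b≡ : b′ ≡ b
  b≡ = +-cancelˡ-≡ a₀ b′ b (+-cancelʳ-≡ c (a₀ + b′) (a₀ + b) (suc-injective (trans (sym (size T)) n≡)))

-- Comparing the capacity of the classes with the number of y-steps

-- The number of y-steps left over once m₀ maximal perfect lines are used twice.
left-over : ∀ {s d q x₂ m₀ j₀ j₁ o b C r} → suc (suc s + q) ≡ j₀ + suc m₀ * (s + d) → j₀ + suc j₁ ≡ s + d → b + 3 ≡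
    (s + d) * (2 + x₂) + 2 * (s + d) + o →
            2 + x₂ + b + (C + m₀ * (s + d + (s + d))) ≡ r + (suc s + q) * (2 + x₂) → C + (3 + 2 * q) ≤ q * (2 + x₂) + r
-- The slack d x₂ + o + 2 j₁ vanishes for s = t, b = tx + 2t - 3 and j₀ = t - 1, so the lower bound
-- on b is used up entirely. `T` is added to both sides to avoid subtraction.
left-over {s} {d} {q} {x₂} {m₀} {j₀} {j₁} {o} {b} {C} {r} e₁ e₂ e₃ e₄ = ≤-trans (m≤m+n (C + (3 + 2 * q)) (d * x₂ + o + 2 * j₁))
    (≤-reflexive (+-cancelʳ-≡ T _ _ (trans (lhs s d q x₂ m₀ j₀ j₁ o b C)
        (trans (cong₂ _+_ (cong₂ _+_ e₄ (sym e₃)) (cong₂ _+_ (cong (2 *_) e₁) (cong (2 *_) e₂))) (rhs s d q x₂ m₀ j₀ b r)))))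
  where
  T = b + 2 * (m₀ * (s + d)) + 2 * j₀ + 2 * (s + d) + (2 + x₂ + s * (2 + x₂) + 2 * s + 2 * d + 3)
  lhs : ∀ s d q x₂ m₀ j₀ j₁ o b C → C + (3 + 2 * q) + (d * x₂ + o + 2 * j₁) +
      (b + 2 * (m₀ * (s + d)) + 2 * j₀ + 2 * (s + d) + (2 + x₂ + s * (2 + x₂) + 2 * s + 2 * d + 3)) ≡
        2 + x₂ + b + (C + m₀ * (s + d + (s + d))) + ((s + d) * (2 + x₂) + 2 * (s + d) + o) +
            (2 * suc (suc s + q) + 2 * (j₀ + suc j₁))
  lhs = solve-∀
  rhs : ∀ s d q x₂ m₀ j₀ b r → r + (suc s + q) * (2 + x₂) + (b + 3) + (2 * (j₀ + suc m₀ * (s + d)) + 2 * (s + d)) ≡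
        q * (2 + x₂) + r + (b + 2 * (m₀ * (s + d)) + 2 * j₀ + 2 * (s + d) + (2 + x₂ + s * (2 + x₂) + 2 * s + 2 * d + 3))
  rhs = solve-∀

-- Here s is the number of ones that the lines need: t in general, 2 for t = 3. Either way 3s + 5 ≤
-- 4t, from t = 5 on in the first case. With 2t ≤ 2 + s + q this gives 2t ≤ 3q + 1, so a remainder
-- mod 2t fits into three lines.
module _ {x₂ t′ s : ℕ} (oˣ : Odd (2+ x₂)) (oᵗ : Odd (suc t′)) (1≤t′ : 1 ≤ t′) (s≤t : s ≤ suc t′) (s-bound : 3 * s + 5 ≤ 4 * suc t′)
  (line : ∀ α γ → s ≤ α → Mono 0 (suc t′) α γ) (a b c : ℕ) (x≤a : 2+ x₂ ≤ a) (b-bound : suc t′ * 2+ x₂ + 2 * suc t′ ≤ b + 3) where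

  private
    x = 2+ x₂
    t = suc t′
    Goal = LinearRealization (a + b + c + 1) (mset a x b (t * x) c)

    tx<b : t * x + 1 ≤ b
    tx<b = +-cancelʳ-≤ 3 _ b (≤-trans (≤-trans (≤-reflexive (+-assoc (t * x) 1 3))
        (+-monoʳ-≤ (t * x) (*-monoʳ-≤ 2 (s≤s 1≤t′)))) b-bound)

  module _ {r h q : ℕ} (r<x : r < x) (E : x + b + c ≡ r + suc h * x) (s+q : s + q ≡ h) (t≤h : t ≤ h) where

    open Line-cases x t′ s q h line (cong suc (sym s+q)) t≤h 1≤t′ using (even-lines; equal-lines; odd-lines)

    -- As b is at least sx, at most qx + r y-steps are left, which is what the classes can hold.
    case₄-even : Even r → Goal
    case₄-even (i , refl) with gap r<x
    ... | S , R+S with odd-suc (odd∸even (i , refl) (subst Odd (sym R+S) oˣ))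
    ... | j , refl with m≤n⇒∃[o]m+o≡n (≤-trans (*-monoˡ-≤ x s≤t) (≤-trans (m≤m+n _ 1) tx<b))
    ... | o , s+o = finish-lines a b (proj₂ (proj₂ (even-lines {i} {j} x≡ bound)))
        (≤-trans (≤-trans (n≤1+n _) (≤-reflexive a₀)) x≤a)
        (trans (eq₁ i h x) (trans (sym E) (cong (λ z → z + b + c) (sym a₀))))
      where
      eq₀ : ∀ i j → i * 2 + suc (j * 2) ≡ i + i + suc (j + j)
      eq₀ = solve-∀
      x≡ : i * 2 + suc (j * 2) ≡ x
      x≡ = trans (eq₀ i j) R+S
      eq₁ : ∀ i h x → suc h * x + i * 2 ≡ i + i + suc h * x
      eq₁ = solve-∀
      a₀ : suc (i * 2 + (j * 2 + 0)) ≡ x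
      a₀ = trans (trans (sym (+-suc (i * 2) (j * 2 + 0))) (cong (λ z → i * 2 + suc z) (+-identityʳ (j * 2)))) x≡
      lhs : ∀ x s o c → x + s * x + (o + c) ≡ x + (s * x + o) + c
      lhs = solve-∀
      rhs : ∀ i j x s q → i + i + suc (s + q) * x ≡ x + s * x + (q * x + i * 2)
      rhs = solve-∀
      full : ∀ i j q → q * (i * 2 + suc (j * 2)) + i * 2 ≡ i * (suc q + suc q) + (j * (q + q) + q)
      full = solve-∀
      bound : c ≤ i * (suc q + suc q) + (j * (q + q) + q)
      bound = ≤-trans (m≤n+m c o) (≤-reflexive (trans (+-cancelˡ-≡ (x + s * x) _ _
          (trans (lhs x s o c) (trans (cong (λ b → x + b + c) s+o)
        (trans E (trans (cong (λ h → i + i + suc h * x) (sym s+q)) (rhs i j x s q))))))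
            (trans (cong (λ x → q * x + i * 2) (sym x≡)) (full i j q))))

    case₄-one : r ≡ 1 → Goal
    case₄-one refl with odd-suc oˣ
    ... | j , suc-x with m≤n⇒∃[o]m+o≡n (≤-trans (+-monoˡ-≤ 1 (*-monoˡ-≤ x s≤t)) tx<b)
    ... | o , s+o = finish-lines a b (proj₂ (proj₂ (equal-lines {j} x≡ bound))) (≤-trans (≤-trans (n≤1+n _) (≤-reflexive a₀)) x≤a)
        (trans (sym E) (cong (λ z → z + b + c) (sym a₀)))
      where
      eq₀ : ∀ j → suc (j * 2) ≡ suc (j + j)
      eq₀ = solve-∀
      x≡ : suc (j * 2) ≡ x
      x≡ = trans (eq₀ j) (cong suc (sym suc-x))
      a₀ : suc (j * 2 + 0) ≡ x
      a₀ = trans (cong suc (+-identityʳ (j * 2))) x≡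
      lhs : ∀ x s o c → x + s * x + 1 + (o + c) ≡ x + (s * x + 1 + o) + c
      lhs = solve-∀
      rhs : ∀ x s q → 1 + suc (s + q) * x ≡ x + s * x + 1 + q * x
      rhs = solve-∀
      full : ∀ j q → q * suc (j * 2) ≡ j * (q + q) + q
      full = solve-∀
      bound : c ≤ j * (q + q) + q
      bound = ≤-trans (m≤n+m c o) (≤-reflexive (trans (+-cancelˡ-≡ (x + s * x + 1) _ _
          (trans (lhs x s o c) (trans (cong (λ b → x + b + c) s+o)
        (trans E (trans (cong (λ h → 1 + suc h * x) (sym s+q)) (rhs x s q)))))) (trans (cong (q *_) (sym x≡)) (full j q))))

    case₄-odd : ∀ m₁ → r ≡ suc (suc m₁ + suc m₁) → Goal
    case₄-odd m₁ r≡ with gap r<x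
    ... | S , R+S with odd∸odd (suc m₁ , r≡) (subst Odd (sym R+S) oˣ)
    ... | zero , ()
    ... | suc i , S≡ = spread (divide t′ (2+ h)) (divide (t′ + t) c)
      where
      eq₀ : ∀ m₁ i → 3 + m₁ * 2 + suc i * 2 ≡ suc (suc m₁ + suc m₁) + suc (i + suc i)
      eq₀ = solve-∀
      x≡ : 3 + m₁ * 2 + suc i * 2 ≡ x
      x≡ = trans (eq₀ m₁ i) (trans (cong₂ _+_ (sym r≡) (sym S≡)) R+S)
      r≡′ : r ≡ 3 + m₁ * 2
      r≡′ = trans r≡ (eq m₁)
        where
        eq : ∀ m₁ → suc (suc m₁ + suc m₁) ≡ 3 + m₁ * 2
        eq = solve-∀
      a₀ : suc i * 2 + (m₁ * 2 + 3) ≡ x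
      a₀ = trans (eq m₁ i) x≡
        where
        eq : ∀ m₁ i → suc i * 2 + (m₁ * 2 + 3) ≡ 3 + m₁ * 2 + suc i * 2
        eq = solve-∀
      room : ℕ
      room = suc i * (q + q) + (m₁ * (suc q + suc q) + q)

      conclude : ∀ {j m} C → 2+ h ≡ j + suc m * t → C ≤ room → C + m * (t + t) ≡ c → Goal
      conclude {j} {m} C len bound c≡ with odd-lines {m₁} {suc i} {j} {m} {C} oᵗ len x≡ bound
      ... | e , b′ , T = finish-lines a b (recountᵀ refl refl (trans (eq m t C) c≡) T) (≤-trans (≤-reflexive a₀) x≤a)
          (cong suc (trans (trans (+-comm (suc h * x) (3 + m₁ * 2)) (trans (cong (_+ suc h * x) (sym r≡′)) (sym E)))
              (cong (λ z → z + b + c) (sym a₀))))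
        where
        eq : ∀ m t C → m * t + (m * t + C) ≡ C + m * (t + t)
        eq = solve-∀

      -- The two perfect lines take 2tm y-steps. The quotient of c by 2t is the natural choice for
      -- m, but a long line has room only for m up to m₀.
      spread : (∃₂ λ j₀ d → j₀ < t × 2+ h ≡ j₀ + d * t) → (∃₂ λ r′ d′ → r′ < t + t × c ≡ r′ + d′ * (t + t)) → Goal
      spread (j₀ , zero , j₀<t , len) _ = ⊥-elim (<⇒≱ (≤-trans j₀<t t≤h)
          (≤-trans (≤-trans (n≤1+n h) (n≤1+n (suc h))) (≤-reflexive (trans len (+-identityʳ j₀)))))
      spread (j₀ , suc m₀ , j₀<t , len) (r′ , d′ , r′< , c≡) with ≤-<-connex m₀ d′
      ... | inj₂ d′<m₀ with m≤n⇒∃[o]m+o≡n d′<m₀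
      ... | o , refl = conclude {j₀ + suc o * t} {d′} r′ (trans len (eq j₀ o d′ t)) small (sym c≡)
        where
        eq : ∀ j₀ o d′ t → j₀ + suc (suc d′ + o) * t ≡ j₀ + suc o * t + suc d′ * t
        eq = solve-∀
        -- Here m₀ is at least 1, so a long line has at least 2t vertices.
        two : t + t ≤ 2+ (s + q)
        two = ≤-trans (m≤m+n (t + t) (j₀ + (d′ + o) * t)) (≤-reflexive
            (trans (eq₂ j₀ o d′ t) (trans (sym len) (cong 2+ (sym s+q)))))
          where
          eq₂ : ∀ j₀ o d′ t → t + t + (j₀ + (d′ + o) * t) ≡ j₀ + suc (suc d′ + o) * t
          eq₂ = solve-∀
        three : t + t ≤ q + (q + q) + 1
        three = +-cancelʳ-≤ (3 * s + 5) _ _ (≤-trans (+-monoʳ-≤ (t + t) s-bound)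
            (≤-trans (≤-reflexive (eq₃ t)) (≤-trans (*-monoʳ-≤ 3 two) (≤-reflexive (eq₄ s q)))))
          where
          eq₃ : ∀ t → t + t + 4 * t ≡ 3 * (t + t)
          eq₃ = solve-∀
          eq₄ : ∀ s q → 3 * (2 + (s + q)) ≡ q + (q + q) + 1 + (3 * s + 5)
          eq₄ = solve-∀
        small : r′ ≤ room
        small = ≤-trans (≤-pred (≤-trans r′< (≤-trans three (≤-reflexive (+-comm (q + (q + q)) 1)))))
          (≤-trans (m≤m+n (q + (q + q)) (i * (q + q) + m₁ * (suc q + suc q))) (≤-reflexive (eq₅ i m₁ q)))
          where
          eq₅ : ∀ i m₁ q → q + (q + q) + (i * (q + q) + m₁ * (suc q + suc q)) ≡ suc i * (q + q) + (m₁ * (suc q + suc q) + q)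
          eq₅ = solve-∀
      spread (j₀ , suc m₀ , j₀<t , len) (r′ , d′ , r′< , c≡) | inj₁ m₀≤d′ with m≤n⇒∃[o]m+o≡n m₀≤d′ | m≤n⇒∃[o]m+o≡n s≤t |
          gap j₀<t | m≤n⇒∃[o]m+o≡n b-bound
      ... | o , refl | d , s+d | j₁ , j+j | o′ , b≡ = conclude {j₀} {m₀} (r′ + o * (t + t)) len large
          (trans (eq r′ o m₀ t) (sym c≡))
        where
        eq : ∀ r′ o m₀ t → r′ + o * (t + t) + m₀ * (t + t) ≡ r′ + (m₀ + o) * (t + t)
        eq = solve-∀
        C = r′ + o * (t + t)
        large′ : C + (3 + 2 * q) ≤ q * x + r
        large′ = left-over {s} {d} {q} {x₂} {m₀} {j₀} {j₁} {o′} {b} {C} {r}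
          (trans (cong 2+ s+q) (trans len (cong (λ t → j₀ + suc m₀ * t) (sym s+d))))
          (trans j+j (sym s+d))
          (trans (sym b≡) (cong (λ t → t * x + 2 * t + o′) (sym s+d)))
          (trans (cong (x + b +_) (trans (cong (λ t → C + m₀ * (t + t)) s+d) (trans (eq r′ o m₀ t) (sym c≡))))
              (trans E (cong (λ h → r + suc h * x) (sym s+q))))
        eq₆ : ∀ i m₁ q → q * (3 + m₁ * 2 + suc i * 2) + (3 + m₁ * 2) ≡ suc i * (q + q) + (m₁ * (suc q + suc q) + q) + (3 + 2 * q)
        eq₆ = solve-∀
        large : C ≤ room
        large = +-cancelʳ-≤ (3 + 2 * q) C room (≤-trans large′
            (≤-reflexive (trans (cong₂ (λ x r → q * x + r) (sym x≡) r≡′) (eq₆ i m₁ q))))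

  case₄ : Goal
  case₄ with divide (suc x₂) (x + b + c)
  ... | r , k , r<x , E with ≤-<-connex k t
  ... | inj₁ k≤t = ⊥-elim (<⇒≱ (+-mono-<-≤ r<x (*-monoˡ-≤ x k≤t))
      (≤-trans (+-monoʳ-≤ x (≤-trans (m≤m+n _ 1) tx<b)) (≤-trans (m≤m+n (x + b) c) (≤-reflexive E))))
  case₄ | r , suc h , r<x , E | inj₂ (s≤s t≤h) with m≤n⇒∃[o]m+o≡n (≤-trans s≤t t≤h) | even⊎odd r
  ... | q , s+q | inj₁ even = case₄-even r<x E s+q t≤h even
  ... | q , s+q | inj₂ (zero , r≡1) = case₄-one r<x E s+q t≤h r≡1
  ... | q , s+q | inj₂ (suc m₁ , r≡) = case₄-odd r<x E s+q t≤h m₁ r≡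

even-of : ∀ {n} → 2 ∣ n → Even n
even-of (divides k refl) = k , trans (*-comm k 2) (cong (k +_) (+-identityʳ k))

odd-of : ∀ {n} → ¬ (2 ∣ n) → Odd n
odd-of {n} 2∤n with even⊎odd n
... | inj₂ o = o
... | inj₁ (k , refl) = ⊥-elim (2∤n (divides k (trans (cong (k +_) (sym (+-identityʳ k))) (*-comm 2 k))))

theorem1p8 : (x y a b c : ℕ) → 1 < x → x < y →
    ((a ≥ x + y ∸ 1)
    ⊎ (a ≥ x + y ∸ 2 × (x ≡ 3 ⊎ 2 ∣ x))
    ⊎ (a ≥ 4 * x ∸ 3 × ¬ (2 ∣ x) × y + 2 > 2 * x × b + 2 * x ≥ y + 2)
    ⊎ (a ≥ x × Σ ℕ (λ t → y ≡ t * x × ¬ (2 ∣ x) × ¬ (2 ∣ t) × b + 3 ≥ t * x + 2 * t))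
    ⊎ (a ≥ 7 × x ≡ 3 × b + 4 ≥ y)) →
    LinearRealization (a + b + c + 1) (mset a x b y c)
theorem1p8 (suc x′) (suc y′) a b c 1<x x<y (inj₁ bound) = case₁ 1<x x<y a b c bound
theorem1p8 (suc x′) (suc y′) a b c 1<x x<y (inj₂ (inj₁ (bound , inj₁ refl))) = case₂-three a b c x<y bound
theorem1p8 (suc x′) (suc y′) a b c 1<x x<y (inj₂ (inj₁ (bound , inj₂ 2∣x))) =
  case₂ 1<x x<y a b c (≤-trans (≤-reflexive (sym (cong (_∸ 1) (+-suc x′ y′)))) bound) (even-of 2∣x)
theorem1p8 2 y a b c 1<x x<y (inj₂ (inj₂ (inj₁ (_ , 2∤x , _)))) = ⊥-elim (2∤x (divides 1 refl))
theorem1p8 1 y a b c (s≤s ()) x<y (inj₂ (inj₂ (inj₁ _)))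
theorem1p8 (suc (2+ ξ)) y a b c 1<x x<y (inj₂ (inj₂ (inj₁ (a-bound , 2∤x , _ , b-bound)))) =
  case₃ a b c (odd-of 2∤x) x<y (≤-trans (≤-reflexive (eqᵃ ξ)) a-bound)
    (+-cancelʳ-≤ 2 y _ (≤-trans b-bound (≤-reflexive (eqᵇ ξ b))))
  where
  eq : ∀ ξ → 3 + ξ + (3 + ξ + (3 + ξ + ξ)) + 3 ≡ 4 * (3 + ξ)
  eq = solve-∀
  eqᵃ : ∀ ξ → 3 + ξ + (3 + ξ + (3 + ξ + ξ)) ≡ 4 * (3 + ξ) ∸ 3
  eqᵃ ξ = trans (sym (m+n∸n≡m _ 3)) (cong (_∸ 3) (eq ξ))
  eqᵇ : ∀ ξ b → b + 2 * (3 + ξ) ≡ b + suc (3 + ξ + ξ) + 2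
  eqᵇ = solve-∀
theorem1p8 1 y a b c (s≤s ()) x<y (inj₂ (inj₂ (inj₂ (inj₁ _))))
theorem1p8 (2+ x₂) _ a b c 1<x x<y (inj₂ (inj₂ (inj₂ (inj₁ (x≤a , 0 , refl , _ , 2∤t , _))))) = ⊥-elim (2∤t (divides 0 refl))
theorem1p8 (2+ x₂) _ a b c 1<x x<y (inj₂ (inj₂ (inj₂ (inj₁ (x≤a , 1 , refl , _))))) = ⊥-elim
    (<⇒≱ x<y (≤-reflexive (*-identityˡ (2+ x₂))))
theorem1p8 (2+ x₂) _ a b c 1<x x<y (inj₂ (inj₂ (inj₂ (inj₁ (x≤a , 2 , refl , _ , 2∤t , _))))) = ⊥-elim (2∤t (divides 1 refl))
theorem1p8 (2+ x₂) _ a b c 1<x x<y (inj₂ (inj₂ (inj₂ (inj₁ (x≤a , 3 , refl , 2∤x , 2∤t , b-bound))))) =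
  case₄ (odd-of 2∤x) (1 , refl) (s≤s z≤n) (s≤s (s≤s z≤n)) (n≤1+n 11) mono₃ a b c x≤a b-bound
theorem1p8 (2+ x₂) _ a b c 1<x x<y (inj₂ (inj₂ (inj₂ (inj₁ (x≤a , 4 , refl , _ , 2∤t , _))))) = ⊥-elim (2∤t (divides 2 refl))
theorem1p8 (2+ x₂) _ a b c 1<x x<y (inj₂ (inj₂ (inj₂ (inj₁ (x≤a , suc (suc (suc (suc (suc t)))) , refl , 2∤x , 2∤t , b-bound))))) =
  case₄ (odd-of 2∤x) (odd-of 2∤t) (s≤s z≤n) ≤-refl (≤-trans (m≤m+n _ t) (≤-reflexive (eq t))) mono a b c x≤a b-bound
  where
  eq : ∀ t → 3 * (5 + t) + 5 + t ≡ 4 * (5 + t)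
  eq = solve-∀
theorem1p8 _ y a b c 1<x x<y (inj₂ (inj₂ (inj₂ (inj₂ (7≤a , refl , b-bound))))) = case₅ a b c x<y 7≤a b-bound
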